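{- Let $L$ be a multiset of even integers greater than $2$, and set $\epsilon=(2|L|+1)(\max(L)+3)$. Then there is a $\mathcal{GL}(x,y)$ of $\left[L,2\ \middle|\ \epsilon-\sum_{\ell\in L}\ell-2\right]$, where $x=\frac{\max(L)}{2}+1$ and $y=(|L|+1)(\max(L)+3)-1$.
   Context: $\mathcal{I}(a,b)=\{x\in\mathbb{Z}\mid a\le x\le b\}$; $|L|$ counts multiplicity; the maximum of an empty multiset is $0$. For a multiset $L$ of integers $\ge 2$ and $m\ge 0$, $[L\mid m]$ is the vertex-disjoint union of one $\ell$-cycle for each $\ell\in L$ (a $2$-cycle being two vertices joined by two parallel edges) and a path with $m$ edges; $[L,2\mid m]$ means $L$ with one extra $2$ added. Its number of edges is $\epsilon=\sum\ell+m$. A labeling is an isomorphic copy with distinct integer vertices; $\Delta\Gamma$ is the multiset of differences $x-y$ over ordered pairs of adjacent vertices (parallel edges counted separately). A $\mathcal{GL}(x,y)$ (graceful labeling with path ends $x,y$) of such a graph with $\epsilon$ edges and at most one $2$-cycle is a labeling $\Gamma$ with vertex set $\mathcal{I}(0,\epsilon)$, path end-vertices $x$ and $y$, and $\Delta\Gamma=\pm\mathcal{I}(1,\epsilon)$ if there is no $2$-cycle, $\Delta\Gamma=\pm\{1,3,3\}\cup\pm\mathcal{I}(4,\epsilon)$ (as multisets) if there is exactly one $2$-cycle. -}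

module Defs where

open import Data.Nat as ℕ using (ℕ; zero; suc; _≤_; _∸_; _⊔_; _≟_)
open import Data.Integer as ℤ using (ℤ; +_; -_; _-_)
open import Data.List using (List; []; _∷_; _++_; map; length; concat; upTo; foldr; filter; head; last)
open import Data.Nat.ListAction using (sum)
open import Data.Maybe using (just)
open import Data.Product using (_×_; _,_)
open import Relation.Binary.PropositionalEquality using (_≡_)
open import Data.List.Relation.Binary.Permutation.Propositional using (_↭_)

maxL : List ℕ → ℕ
maxL = foldr _⊔_ 0

twos : List ℕ → ℕ
twos L = length (filter (_≟ 2) L)

interval : ℕ → ℕ → List ℤ
interval a b = map (λ i → + (a ℕ.+ i)) (upTo (suc b ∸ a))

pm : List ℤ → List ℤ
pm xs = xs ++ map -_ xs

pairs : List ℤ → List (ℤ × ℤ)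
pairs (a ∷ b ∷ r) = (a , b) ∷ pairs (b ∷ r)
pairs _ = []

-- edges of a cycle given by its vertices in cyclic order
-- (for a 2-cycle [a,b] this yields the two parallel edges (a,b),(b,a))
cycleEdges : List ℤ → List (ℤ × ℤ)
cycleEdges [] = []
cycleEdges (v ∷ vs) = pairs (v ∷ vs ++ v ∷ [])

edgeDiffs : ℤ × ℤ → List ℤ
edgeDiffs (u , v) = (u - v) ∷ (v - u) ∷ []

targetDiffs : ℕ → ℕ → List ℤ
targetDiffs zero ε = pm (interval 1 ε)
targetDiffs (suc _) ε = pm (+ 1 ∷ + 3 ∷ + 3 ∷ interval 4 ε)

-- A labeling Γ of [L | m] (one cycle per element of L, plus a path with m
-- edges), with integer vertex labels, which is a GL(x,y).
record GL (L : List ℕ) (m : ℕ) (x y : ℤ) : Set where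
  field
    cycles    : List (List ℤ)
    path      : List ℤ
    cycleLens : map length cycles ≡ L
    pathLen   : length path ≡ suc m
    atMostOne2 : twos L ≤ 1
    -- vertex set is exactly I(0,ε) (in particular labels are distinct)
    vertices  : concat cycles ++ path ↭ interval 0 (sum L ℕ.+ m)
    pathStart : head path ≡ just x
    pathEnd   : last path ≡ just y
    diffs     : concat (map edgeDiffs (concat (map cycleEdges cycles) ++ pairs path))
                  ↭ targetDiffs (twos L) (sum L ℕ.+ m)

{-# OPTIONS --safe #-}
module Submission where

-- Let n = max(L)/2 + 1 and N = 2n + 1. The labeling is built from the inside out, one
-- member ℓ = 2c of L at a time: the labels obtained so far, 0 … ε, are translated by N, and
-- N "low" labels are added below them and N "high" labels above them. All new edges
-- join a low to a high label. With both groups of new labels recentred to [-n, n], the task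
-- no longer depends on what is inside: find a 2c-cycle and a path from low 0 to high 0 that
-- together use every new label once and whose differences high - low are -2n … 2n, each
-- once (a Tiling). The edge from high 0 to the old start of the path has difference ε + 1.
--
-- Tilings for all 2 ≤ c < n come from finitely many by local surgery near ±n. If the path
-- contains the edge between low (n-2) and high (n-2), zigzags through the labels beyond
-- ±n can be inserted there, which raises n by 3, 4 or 5 and keeps c (grow). If moreover
-- the cycle contains the edges {low -n, high n} and {low n, high -n}, it can be extended at
-- these at the same time, which raises (n, c) by (3, 4) (widen).
--
-- Innermost, with h = max(L)/2, lie the 2-cycle {h, h+3} and a path h+1, h+2, … that
-- zigzags between the labels below h and those above h+3.

open import Defs
open import Data.Nat using (ℕ; zero; suc; _+_; _*_; _∸_; _<_; _≤_; _/_; _≟_; z≤n; s≤s; s≤s⁻¹)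
import Data.Nat.Properties as ℕ
open import Data.Nat.Divisibility using (_∣_; divides)
open import Data.Nat.DivMod using (m*n/n≡m)
open import Data.Nat.ListAction using (sum)
open import Data.Nat.ListAction.Properties using (sum-++)
open import Data.Nat.Tactic.RingSolver using (solve-∀)
open import Data.Integer as ℤ using (ℤ; +_; -[1+_]; 0ℤ; -_)
import Data.Integer.Properties as ℤ
import Data.Integer.Tactic.RingSolver as ℤ-Solver
open import Data.Bool using (T)
open import Data.Maybe using (Maybe; just; nothing; is-just; to-witness-T)
open import Data.Maybe.Properties using () renaming (≡-dec to maybe-dec)
open import Data.List using (List; []; _∷_; _++_; map; length; mapMaybe; concat; concatMap; head; last; upTo; applyUpTo)
open import Data.List.Properties using (map-++; map-∘; map-cong; map-upTo; length-map; length-++; ++-assoc; ∷-injective; concat-map; concatMap-++; concatMap-map; concatMap-cong; filter-reject)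
open import Data.List.Relation.Unary.All as All using (All; []; _∷_)
open import Data.List.Relation.Binary.Pointwise using (Pointwise; []; _∷_)
open import Data.List.Relation.Binary.Permutation.Propositional using (_↭_; refl; prep; swap; trans; ↭-refl; ↭-sym; ↭-trans; ↭-reflexive; module PermutationReasoning)
open import Data.List.Relation.Binary.Permutation.Propositional.Properties using (++-commutativeMonoid; map⁺; ++⁺; ++⁺ˡ; ++⁺ʳ; ++-comm; shifts; ↭-map-inv; ↭-length)
open import Data.Product as Product using (_×_; _,_; ∃; ∃₂; proj₁; proj₂)
open import Data.Sum using (_⊎_; inj₁; inj₂)
open import Function using (_∘_)
open import Relation.Binary using (DecidableEquality)
open import Relation.Binary.PropositionalEquality as ≡ using (_≡_; _≢_; refl; cong; cong₂; sym; subst; subst₂; module ≡-Reasoning)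
open import Relation.Nullary using (yes; no; contradiction)
import Algebra.Solver.CommutativeMonoid as CMSolver

private variable
  A B : Set
  a b c d : A

-- Lists under `++` up to `↭` form a commutative monoid, so regroupings of blocks of vertices or
-- edges are left to its solver.
module Rearrange (A : Set) = CMSolver (++-commutativeMonoid {A = A})

-- Walks

infixr 5 _▹_ _⁀_

-- Both ends are indices, so the edges created by joining two walks or by closing one are known from
-- the types, and no walk is empty.
data Walk {A : Set} : A → A → Set where
  ⟪_⟫ : ∀ a → Walk a a
  _▹_ : ∀ a {b c} → Walk b c → Walk a c

verts : Walk {A} a b → List A
verts ⟪ a ⟫ = a ∷ []
verts (a ▹ w) = a ∷ verts w

edges : Walk {A} a b → List (A × A)
edges ⟪ a ⟫ = []
edges (_▹_ a {b} w) = (a , b) ∷ edges w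

loop : Walk {A} a b → List (A × A)
loop {a = a} {b} w = (b , a) ∷ edges w

_⁀_ : Walk {A} a b → Walk c d → Walk a d
⟪ a ⟫ ⁀ w = a ▹ w
(a ▹ v) ⁀ w = a ▹ (v ⁀ w)

verts-⁀ : (v : Walk {A} a b) (w : Walk c d) → verts (v ⁀ w) ≡ verts v ++ verts w
verts-⁀ ⟪ a ⟫ w = refl
verts-⁀ (a ▹ v) w = cong (a ∷_) (verts-⁀ v w)

edges-⁀ : (v : Walk {A} a b) (w : Walk c d) → edges (v ⁀ w) ≡ edges v ++ (b , c) ∷ edges w
edges-⁀ ⟪ a ⟫ w = refl
edges-⁀ (a ▹ v) w = cong (_ ∷_) (edges-⁀ v w)

map² : (A → B) → A × A → B × B
map² f = Product.map f f

mapWalk : (f : A → B) → Walk a b → Walk (f a) (f b)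
mapWalk f ⟪ a ⟫ = ⟪ f a ⟫
mapWalk f (a ▹ w) = f a ▹ mapWalk f w

verts-map : (f : A → B) (w : Walk a b) → verts (mapWalk f w) ≡ map f (verts w)
verts-map f ⟪ a ⟫ = refl
verts-map f (a ▹ w) = cong (f a ∷_) (verts-map f w)

edges-map : (f : A → B) (w : Walk a b) → edges (mapWalk f w) ≡ map (map² f) (edges w)
edges-map f ⟪ a ⟫ = refl
edges-map f (a ▹ w) = cong (_ ∷_) (edges-map f w)

-- Permutations checked by computation

module Decide {A : Set} (_≟_ : DecidableEquality A) where

  remove : ∀ x ys → Maybe (∃ λ zs → x ∷ zs ↭ ys)
  remove x [] = nothing
  remove x (y ∷ ys) with x ≟ y
  ... | yes refl = just (ys , ↭-refl)
  ... | no _ with remove x ys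
  ...   | nothing = nothing
  ...   | just (zs , p) = just (y ∷ zs , ↭-trans (swap x y ↭-refl) (prep y p))

  perm? : ∀ xs ys → Maybe (xs ↭ ys)
  perm? [] [] = just ↭-refl
  perm? [] (_ ∷ _) = nothing
  perm? (x ∷ xs) ys with remove x ys
  ... | nothing = nothing
  ... | just (zs , p) with perm? xs zs
  ...   | nothing = nothing
  ...   | just q = just (↭-trans (prep x q) p)

  -- Only positive answers are needed, so a failed search carries no proof. For concrete lists the
  -- implicit argument computes to the unit type and is filled in by type checking.
  decide : ∀ {xs ys} {_ : T (is-just (perm? xs ys))} → xs ↭ ys
  decide {xs} {ys} {t} = to-witness-T (perm? xs ys) t

-- Symmetric ranges of integers

-- Defined by recursion so that `dbl (p + k)` unfolds for a numeral p, and with it the shells of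
-- rises.
dbl : ℕ → ℕ
dbl zero = zero
dbl (suc k) = suc (suc (dbl k))

dbl-+ : ∀ k → dbl k ≡ k + k
dbl-+ zero = refl
dbl-+ (suc k) = cong suc (≡.trans (cong suc (dbl-+ k)) (sym (ℕ.+-suc k k)))

-- With core 0 this is the range [-m, m]; with an empty core, the same without 0. Shells are listed
-- from the outside in, so raising m by a numeral prepends entries definitionally.
shells : List ℤ → ℕ → List ℤ
shells core zero = core
shells core (suc m) = + suc m ∷ -[1+ m ] ∷ shells core m

shells-core : ∀ x m → shells (x ∷ []) m ↭ x ∷ shells [] m
shells-core x zero = ↭-refl
shells-core x (suc m) = ↭-trans (prep _ (prep _ (shells-core x m)))
  (↭-trans (prep _ (swap _ x ↭-refl)) (swap _ x ↭-refl))

-- Bipartite labelings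

data Vertex (A : Set) : Set where
  low high : A → Vertex A

mapV : (A → B) → Vertex A → Vertex B
mapV f (low x) = low (f x)
mapV f (high x) = high (f x)

vertex-dec : DecidableEquality A → DecidableEquality (Vertex A)
vertex-dec _≟_ (low x) (low y) with x ≟ y
... | yes refl = yes refl
... | no x≢y = no λ { refl → x≢y refl }
vertex-dec _≟_ (high x) (high y) with x ≟ y
... | yes refl = yes refl
... | no x≢y = no λ { refl → x≢y refl }
vertex-dec _≟_ (low _) (high _) = no λ ()
vertex-dec _≟_ (high _) (low _) = no λ ()

-- An edge inside one group has no rise, so a permutation between rises and
-- `map just ds` also certifies that every edge is low–high.
rise : Vertex ℤ × Vertex ℤ → Maybe ℤ
rise (low x , high y) = just (y ℤ.- x)
rise (high y , low x) = just (y ℤ.- x)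
rise _ = nothing

square : ℕ → List (Vertex ℤ)
square n = map low (shells (0ℤ ∷ []) n) ++ map high (shells (0ℤ ∷ []) n)

record Tiling (n c : ℕ) : Set where
  field
    path : Walk (low 0ℤ) (high 0ℤ)
    {start end} : Vertex ℤ
    cycle : Walk start end
    size : length (verts cycle) ≡ dbl c
    vertices : verts path ++ verts cycle ↭ square n
    rises : map rise (edges path ++ loop cycle) ↭ map just (shells (0ℤ ∷ []) (dbl n))

-- A tiling with n = 2 + k, cut at the path edge {high k, low k}. That edge has
-- rise 0, hence the missing core of the range of rises.
record Joint (k c : ℕ) : Set where
  field
    left : Walk (low 0ℤ) (high (+ k))
    right : Walk (low (+ k)) (high 0ℤ)
    {start end} : Vertex ℤ
    cycle : Walk start end
    size : length (verts cycle) ≡ dbl c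
    vertices : verts left ++ verts right ++ verts cycle ↭ square (2 + k)
    rises : map rise (edges left ++ edges right ++ loop cycle) ↭ map just (shells [] (dbl (2 + k)))

close : ∀ {k c} → Joint k c → Tiling (2 + k) c
close {k} J = record
  { path = left ⁀ right
  ; cycle = cycle
  ; size = size
  ; vertices = subst (_↭ square (2 + k)) (≡.trans (sym (++-assoc (verts left) _ _)) (cong (_++ verts cycle) (sym (verts-⁀ left right)))) vertices
  ; rises = begin
      map rise (edges (left ⁀ right) ++ loop cycle)
        ≡⟨ cong (λ es → map rise (es ++ loop cycle)) (edges-⁀ left right) ⟩
      map rise ((edges left ++ (high (+ k) , low (+ k)) ∷ edges right) ++ loop cycle)
        ↭⟨ map⁺ rise (solve 4 (λ l m r o → (l ⊕ m ⊕ r) ⊕ o ⊜ m ⊕ l ⊕ r ⊕ o) ↭-refl (edges left) (_ ∷ []) (edges right) (loop cycle)) ⟩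
      just (+ k ℤ.- + k) ∷ map rise (edges left ++ edges right ++ loop cycle)
        ≡⟨ cong (λ x → just x ∷ map rise (edges left ++ edges right ++ loop cycle)) (ℤ.+-inverseʳ (+ k)) ⟩
      just 0ℤ ∷ map rise (edges left ++ edges right ++ loop cycle)
        ↭⟨ prep _ rises ⟩
      map just (0ℤ ∷ shells [] (dbl (2 + k)))
        ↭⟨ map⁺ just (shells-core 0ℤ (dbl (2 + k))) ⟨
      map just (shells (0ℤ ∷ []) (dbl (2 + k))) ∎ }
  where
  open Joint J
  open PermutationReasoning
  open Rearrange (Vertex ℤ × Vertex ℤ)

-- As Joint, with the cycle also cut at its edges {low -n, high n} and {low n, high -n},
-- of rises ±2n.
record Open (k c : ℕ) : Set where
  field
    left : Walk (low 0ℤ) (high (+ k))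
    right : Walk (low (+ k)) (high 0ℤ)
    arc₁ : Walk (high (+ (2 + k))) (high -[1+ 1 + k ])
    arc₂ : Walk (low (+ (2 + k))) (low -[1+ 1 + k ])
    size : length (verts arc₁ ++ verts arc₂) ≡ dbl c
    vertices : verts left ++ verts right ++ verts arc₁ ++ verts arc₂ ↭ square (2 + k)
    rises : map rise (edges left ++ edges right ++ edges arc₁ ++ edges arc₂) ↭ map just (shells [] (3 + dbl k))

-- Surgery near the ends of the ranges

-- k ⟦ o ⟧ is b + k or -(1 + b + k). Adding a numeral to k then adds it to b
-- definitionally, so the surgeries can be checked by computation on offsets.
data Offset : Set where
  pos neg : ℕ → Offset

_⟦_⟧ : ℕ → Offset → ℤ
k ⟦ pos b ⟧ = + (b + k)
k ⟦ neg b ⟧ = -[1+ b + k ]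

at : ℕ → Vertex Offset → Vertex ℤ
at k = mapV (k ⟦_⟧)

offset-dec : DecidableEquality Offset
offset-dec (pos a) (pos b) with a ≟ b
... | yes refl = yes refl
... | no a≢b = no λ { refl → a≢b refl }
offset-dec (neg a) (neg b) with a ≟ b
... | yes refl = yes refl
... | no a≢b = no λ { refl → a≢b refl }
offset-dec (pos _) (neg _) = no λ ()
offset-dec (neg _) (pos _) = no λ ()

-- Placed at k, these are the values ±(lo + k + 1), ..., ±(lo + k + p), the p shells just outside
-- radius lo + k. For vertices the old radius is n = 2 + k; for rises it is 2n = 4 + `dbl k`.
layers : ℕ → ℕ → List Offset
layers lo zero = []
layers lo (suc p) = pos (suc (p + lo)) ∷ neg (p + lo) ∷ layers lo p

-- The symbolic form of `rise` for ends of opposite signs: k enters the difference twice, so the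
-- result is an offset from `dbl k`. Ends of equal sign, whose difference would not depend on k, are
-- rejected.
cross : Vertex Offset × Vertex Offset → Maybe Offset
cross (low (neg a) , high (pos b)) = just (pos (suc (a + b)))
cross (high (pos b) , low (neg a)) = just (pos (suc (a + b)))
cross (low (pos a) , high (neg b)) = just (neg (b + a))
cross (high (neg b) , low (pos a)) = just (neg (b + a))
cross _ = nothing

pos-neg : ∀ a b k → + (b + k) ℤ.- -[1+ a + k ] ≡ + (suc (a + b) + dbl k)
pos-neg a b k = cong +_ (≡.trans (lemma a b k) (cong (λ z → suc (a + b) + z) (sym (dbl-+ k))))
  where
  lemma : ∀ a b k → b + k + suc (a + k) ≡ suc (a + b) + (k + k)
  lemma = solve-∀

neg-minus : ∀ m n → -[1+ m ] ℤ.- + n ≡ -[1+ m + n ]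
neg-minus m zero = cong -[1+_] (sym (ℕ.+-identityʳ m))
neg-minus m (suc n) = cong -[1+_] (sym (ℕ.+-suc m n))

neg-pos : ∀ a b k → -[1+ b + k ] ℤ.- + (a + k) ≡ -[1+ b + a + dbl k ]
neg-pos a b k = ≡.trans (neg-minus (b + k) (a + k))
  (cong -[1+_] (≡.trans (lemma a b k) (cong (λ z → b + a + z) (sym (dbl-+ k)))))
  where
  lemma : ∀ a b k → b + k + (a + k) ≡ b + a + (k + k)
  lemma = solve-∀

rise-at : ∀ k e {o} → cross e ≡ just o → rise (map² (at k) e) ≡ just (dbl k ⟦ o ⟧)
rise-at k (low (neg a) , high (pos b)) refl = cong just (pos-neg a b k)
rise-at k (high (pos b) , low (neg a)) refl = cong just (pos-neg a b k)
rise-at k (low (pos a) , high (neg b)) refl = cong just (neg-pos a b k)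
rise-at k (high (neg b) , low (pos a)) refl = cong just (neg-pos a b k)

rises-at : ∀ k es {os} → map cross es ≡ map just os →
  map rise (map (map² (at k)) es) ≡ map just (map (dbl k ⟦_⟧) os)
rises-at k [] {[]} _ = refl
rises-at k (e ∷ es) {o ∷ os} eq with ∷-injective eq
... | eq₁ , eq₂ = cong₂ _∷_ (rise-at k e eq₁) (rises-at k es eq₂)

-- The edge cut in the joint is moved outwards, from {high k, low k} to {high (p + k), low (p + k)};
-- its rise stays 0. `I` and `J`, with the two edges attaching them to the old ends, must use
-- exactly the p new shells of labels on both sides and the 2p new shells of rises. `eqV` and `eqD`
-- are hypotheses because they hold by `refl` only once p is a numeral.
extend : ∀ p {k c a b} (I : Walk a (high (pos p))) (J : Walk (low (pos p)) b) {os} →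
  verts I ++ verts J ↭ map low (layers 2 p) ++ map high (layers 2 p) →
  map cross ((high (pos 0) , a) ∷ edges I ++ (b , low (pos 0)) ∷ edges J) ≡ map just os →
  os ↭ layers 4 (dbl p) →
  (∀ core → shells core (2 + (p + k)) ≡ map (k ⟦_⟧) (layers 2 p) ++ shells core (2 + k)) →
  shells [] (dbl (2 + (p + k))) ≡ map (dbl k ⟦_⟧) (layers 4 (dbl p)) ++ shells [] (dbl (2 + k)) →
  Joint k c → Joint (p + k) c
extend p {k} {a = a} {b} I J {os} newV cr newD eqV eqD T = record
  { left = left ⁀ I′
  ; right = J′ ⁀ right
  ; cycle = cycle
  ; size = size
  ; vertices = begin
      verts (left ⁀ I′) ++ verts (J′ ⁀ right) ++ verts cycle
        ≡⟨ cong₂ (λ xs ys → xs ++ ys ++ verts cycle) (≡.trans (verts-⁀ left I′) (cong (verts left ++_) (verts-map (at k) I)))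
             (≡.trans (verts-⁀ J′ right) (cong (_++ verts right) (verts-map (at k) J))) ⟩
      (verts left ++ map (at k) (verts I)) ++ (map (at k) (verts J) ++ verts right) ++ verts cycle
        ↭⟨ RV.solve 5 (λ l i j r o → (l RV.⊕ i) RV.⊕ (j RV.⊕ r) RV.⊕ o RV.⊜ (i RV.⊕ j) RV.⊕ l RV.⊕ r RV.⊕ o) ↭-refl
             (verts left) (map (at k) (verts I)) (map (at k) (verts J)) (verts right) (verts cycle) ⟩
      (map (at k) (verts I) ++ map (at k) (verts J)) ++ verts left ++ verts right ++ verts cycle
        ≡⟨ cong (_++ (verts left ++ verts right ++ verts cycle)) (map-++ (at k) (verts I) (verts J)) ⟨
      map (at k) (verts I ++ verts J) ++ verts left ++ verts right ++ verts cycle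
        ↭⟨ ++⁺ (map⁺ (at k) newV) vertices ⟩
      map (at k) (map low (layers 2 p) ++ map high (layers 2 p)) ++ square (2 + k)
        ≡⟨ cong (_++ square (2 + k)) (≡.trans (map-++ (at k) (map low (layers 2 p)) _) (cong₂ _++_ (retag low (λ _ → refl) (layers 2 p)) (retag high (λ _ → refl) (layers 2 p)))) ⟩
      (map low new ++ map high new) ++ map low old ++ map high old
        ↭⟨ RV.solve 4 (λ l h l′ h′ → (l RV.⊕ h) RV.⊕ l′ RV.⊕ h′ RV.⊜ (l RV.⊕ l′) RV.⊕ h RV.⊕ h′) ↭-refl
             (map low new) (map high new) (map low old) (map high old) ⟩
      (map low new ++ map low old) ++ map high new ++ map high old
        ≡⟨ cong₂ _++_ (map-++ low new old) (map-++ high new old) ⟨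
      map low (new ++ old) ++ map high (new ++ old)
        ≡⟨ cong (λ xs → map low xs ++ map high xs) (eqV _) ⟨
      square (2 + (p + k)) ∎
  ; rises = begin
      map rise (edges (left ⁀ I′) ++ edges (J′ ⁀ right) ++ loop cycle)
        ≡⟨ cong₂ (λ xs ys → map rise (xs ++ ys ++ loop cycle))
             (≡.trans (edges-⁀ left I′) (cong (λ es → edges left ++ map² (at k) (high (pos 0) , a) ∷ es) (edges-map (at k) I)))
             (≡.trans (edges-⁀ J′ right) (cong (_++ _ ∷ edges right) (edges-map (at k) J))) ⟩
      map rise ((edges left ++ map (map² (at k)) ((high (pos 0) , a) ∷ edges I)) ++ (map (map² (at k)) (edges J) ++ map² (at k) (b , low (pos 0)) ∷ edges right) ++ loop cycle)
        ↭⟨ map⁺ rise (RE.solve 6 (λ l i j m r o → (l RE.⊕ i) RE.⊕ (j RE.⊕ m RE.⊕ r) RE.⊕ o RE.⊜ (i RE.⊕ m RE.⊕ j) RE.⊕ l RE.⊕ r RE.⊕ o) ↭-refl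
             (edges left) (map (map² (at k)) ((high (pos 0) , a) ∷ edges I)) (map (map² (at k)) (edges J)) (_ ∷ []) (edges right) (loop cycle)) ⟩
      map rise ((map (map² (at k)) ((high (pos 0) , a) ∷ edges I) ++ map (map² (at k)) ((b , low (pos 0)) ∷ edges J)) ++ edges left ++ edges right ++ loop cycle)
        ≡⟨ cong (λ es → map rise (es ++ edges left ++ edges right ++ loop cycle)) (map-++ (map² (at k)) ((high (pos 0) , a) ∷ edges I) _) ⟨
      map rise (map (map² (at k)) ((high (pos 0) , a) ∷ edges I ++ (b , low (pos 0)) ∷ edges J) ++ edges left ++ edges right ++ loop cycle)
        ≡⟨ map-++ rise (map (map² (at k)) ((high (pos 0) , a) ∷ edges I ++ (b , low (pos 0)) ∷ edges J)) _ ⟩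
      map rise (map (map² (at k)) ((high (pos 0) , a) ∷ edges I ++ (b , low (pos 0)) ∷ edges J)) ++ map rise (edges left ++ edges right ++ loop cycle)
        ≡⟨ cong (_++ _) (rises-at k ((high (pos 0) , a) ∷ edges I ++ (b , low (pos 0)) ∷ edges J) cr) ⟩
      map just (map (dbl k ⟦_⟧) os) ++ map rise (edges left ++ edges right ++ loop cycle)
        ↭⟨ ++⁺ (map⁺ just (map⁺ (dbl k ⟦_⟧) newD)) rises ⟩
      map just (map (dbl k ⟦_⟧) (layers 4 (dbl p))) ++ map just (shells [] (dbl (2 + k)))
        ≡⟨ map-++ just (map (dbl k ⟦_⟧) (layers 4 (dbl p))) _ ⟨
      map just (map (dbl k ⟦_⟧) (layers 4 (dbl p)) ++ shells [] (dbl (2 + k)))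
        ≡⟨ cong (map just) eqD ⟨
      map just (shells [] (dbl (2 + (p + k)))) ∎ }
  where
  open Joint T
  open PermutationReasoning
  module RV = Rearrange (Vertex ℤ)
  module RE = Rearrange (Vertex ℤ × Vertex ℤ)
  I′ = mapWalk (at k) I
  J′ = mapWalk (at k) J
  new = map (k ⟦_⟧) (layers 2 p)
  old = shells (0ℤ ∷ []) (2 + k)
  retag : (f : ∀ {A : Set} → A → Vertex A) → (∀ o → at k (f o) ≡ f (k ⟦ o ⟧)) → ∀ xs → map (at k) (map f xs) ≡ map f (map (k ⟦_⟧) xs)
  retag f eq [] = refl
  retag f eq (x ∷ xs) = cong₂ _∷_ (eq x) (retag f eq xs)

module DecideCorner = Decide (vertex-dec offset-dec)
module DecideOffset = Decide offset-dec
module DecideVertex = Decide (vertex-dec ℤ._≟_)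
module DecideRise = Decide (maybe-dec ℤ._≟_)

-- `mapMaybe` would drop an edge that `cross` rejects; the equation `cr` of `extend`, proved by
-- `refl`, shows that none is dropped.
offsets : ∀ {p a b} → Walk a (high (pos p)) → Walk (low (pos p)) b → List Offset
offsets {a = a} {b} I J = mapMaybe cross ((high (pos 0) , a) ∷ edges I ++ (b , low (pos 0)) ∷ edges J)

-- In grow and widen, the half of the inserted vertices that follows low (n-2) mirrors
-- the other half under the exchange of low and high, which negates the rises. The
-- insertions and the explicit tilings below were found by computer search.

grow3 : ∀ {k c} → Joint k c → Joint (3 + k) c
grow3 = extend 3 I J {os = offsets I J} DecideCorner.decide refl DecideOffset.decide (λ _ → refl) refl
  where
  I : Walk (low (neg 4)) (high (pos 3))
  I = low (neg 4) ▹ high (pos 5) ▹ low (neg 3) ▹ high (pos 4) ▹ low (neg 2) ▹ ⟪ high (pos 3) ⟫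
  J : Walk (low (pos 3)) (high (neg 4))
  J = low (pos 3) ▹ high (neg 2) ▹ low (pos 4) ▹ high (neg 3) ▹ low (pos 5) ▹ ⟪ high (neg 4) ⟫

grow4 : ∀ {k c} → Joint k c → Joint (4 + k) c
grow4 = extend 4 I J {os = offsets I J} DecideCorner.decide refl DecideOffset.decide (λ _ → refl) refl
  where
  I : Walk (low (neg 4)) (high (pos 4))
  I = low (neg 4) ▹ high (pos 5) ▹ low (neg 5) ▹ high (pos 6) ▹ low (neg 2) ▹ high (pos 3) ▹ low (neg 3) ▹ ⟪ high (pos 4) ⟫
  J : Walk (low (pos 4)) (high (neg 4))
  J = low (pos 4) ▹ high (neg 3) ▹ low (pos 3) ▹ high (neg 2) ▹ low (pos 6) ▹ high (neg 5) ▹ low (pos 5) ▹ ⟪ high (neg 4) ⟫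

grow5 : ∀ {k c} → Joint k c → Joint (5 + k) c
grow5 = extend 5 I J {os = offsets I J} DecideCorner.decide refl DecideOffset.decide (λ _ → refl) refl
  where
  I : Walk (low (neg 4)) (high (pos 5))
  I = low (neg 4) ▹ high (pos 3) ▹ low (neg 2) ▹ high (pos 4) ▹ low (neg 5) ▹ high (pos 6) ▹ low (neg 6) ▹ high (pos 7) ▹ low (neg 3) ▹ ⟪ high (pos 5) ⟫
  J : Walk (low (pos 5)) (high (neg 4))
  J = low (pos 5) ▹ high (neg 3) ▹ low (pos 7) ▹ high (neg 6) ▹ low (pos 6) ▹ high (neg 5) ▹ low (pos 4) ▹ high (neg 2) ▹ low (pos 3) ▹ ⟪ high (neg 4) ⟫

-- Explicit tilings, and widening of the cycle. The numbers in a name are n = 2 + k and c.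

core4-5 : Open 2 5
core4-5 = record
  { left = low (+ 0) ▹ high (+ 1) ▹ low (- + 2) ▹ ⟪ high (+ 2) ⟫
  ; right = low (+ 2) ▹ high (- + 2) ▹ low (+ 1) ▹ ⟪ high (+ 0) ⟫
  ; arc₁ = high (+ 4) ▹ low (- + 1) ▹ high (- + 3) ▹ low (+ 3) ▹ ⟪ high (- + 4) ⟫
  ; arc₂ = low (+ 4) ▹ high (- + 1) ▹ low (- + 3) ▹ high (+ 3) ▹ ⟪ low (- + 4) ⟫
  ; size = refl
  ; vertices = DecideVertex.decide
  ; rises = DecideRise.decide }

core4-6 : Open 2 6
core4-6 = record
  { left = low (+ 0) ▹ ⟪ high (+ 2) ⟫
  ; right = low (+ 2) ▹ high (- + 2) ▹ low (+ 1) ▹ ⟪ high (+ 0) ⟫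
  ; arc₁ = high (+ 4) ▹ low (- + 1) ▹ high (- + 3) ▹ low (+ 3) ▹ ⟪ high (- + 4) ⟫
  ; arc₂ = low (+ 4) ▹ high (- + 1) ▹ low (- + 2) ▹ high (+ 1) ▹ low (- + 3) ▹ high (+ 3) ▹ ⟪ low (- + 4) ⟫
  ; size = refl
  ; vertices = DecideVertex.decide
  ; rises = DecideRise.decide }

core4-7 : Open 2 7
core4-7 = record
  { left = low (+ 0) ▹ ⟪ high (+ 2) ⟫
  ; right = low (+ 2) ▹ ⟪ high (+ 0) ⟫
  ; arc₁ = high (+ 4) ▹ low (- + 1) ▹ high (- + 2) ▹ low (+ 1) ▹ high (- + 3) ▹ low (+ 3) ▹ ⟪ high (- + 4) ⟫
  ; arc₂ = low (+ 4) ▹ high (- + 1) ▹ low (- + 2) ▹ high (+ 1) ▹ low (- + 3) ▹ high (+ 3) ▹ ⟪ low (- + 4) ⟫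
  ; size = refl
  ; vertices = DecideVertex.decide
  ; rises = DecideRise.decide }

core5-8 : Open 3 8
core5-8 = record
  { left = low (+ 0) ▹ high (+ 2) ▹ low (- + 4) ▹ ⟪ high (+ 3) ⟫
  ; right = low (+ 3) ▹ ⟪ high (+ 0) ⟫
  ; arc₁ = high (+ 5) ▹ low (- + 3) ▹ high (+ 1) ▹ low (- + 2) ▹ high (- + 1) ▹ low (+ 1) ▹ high (- + 3) ▹ low (+ 2) ▹ high (- + 4) ▹ low (+ 4) ▹ ⟪ high (- + 5) ⟫
  ; arc₂ = low (+ 5) ▹ high (- + 2) ▹ low (- + 1) ▹ high (+ 4) ▹ ⟪ low (- + 5) ⟫
  ; size = refl
  ; vertices = DecideVertex.decide
  ; rises = DecideRise.decide }

joint3-2 : Joint 1 2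
joint3-2 = record
  { left = low (+ 0) ▹ ⟪ high (+ 1) ⟫
  ; right = low (+ 1) ▹ high (- + 1) ▹ low (+ 2) ▹ high (- + 2) ▹ low (+ 3) ▹ high (- + 3) ▹ low (- + 2) ▹ ⟪ high (+ 0) ⟫
  ; cycle = low (- + 3) ▹ high (+ 3) ▹ low (- + 1) ▹ ⟪ high (+ 2) ⟫
  ; size = refl
  ; vertices = DecideVertex.decide
  ; rises = DecideRise.decide }

joint4-2 : Joint 2 2
joint4-2 = record
  { left = low (+ 0) ▹ high (- + 1) ▹ low (+ 1) ▹ ⟪ high (+ 2) ⟫
  ; right = low (+ 2) ▹ high (- + 2) ▹ low (+ 3) ▹ high (- + 3) ▹ low (+ 4) ▹ high (- + 4) ▹ low (- + 1) ▹ high (+ 1) ▹ low (- + 3) ▹ ⟪ high (+ 0) ⟫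
  ; cycle = low (- + 4) ▹ high (+ 4) ▹ low (- + 2) ▹ ⟪ high (+ 3) ⟫
  ; size = refl
  ; vertices = DecideVertex.decide
  ; rises = DecideRise.decide }

joint5-2 : Joint 3 2
joint5-2 = record
  { left = low (+ 0) ▹ high (- + 2) ▹ low (+ 1) ▹ high (- + 3) ▹ low (+ 2) ▹ high (+ 1) ▹ low (- + 4) ▹ high (+ 2) ▹ low (- + 1) ▹ ⟪ high (+ 3) ⟫
  ; right = low (+ 3) ▹ high (- + 4) ▹ low (+ 4) ▹ high (- + 5) ▹ low (+ 5) ▹ high (- + 1) ▹ low (- + 2) ▹ ⟪ high (+ 0) ⟫
  ; cycle = low (- + 5) ▹ high (+ 5) ▹ low (- + 3) ▹ ⟪ high (+ 4) ⟫
  ; size = refl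
  ; vertices = DecideVertex.decide
  ; rises = DecideRise.decide }

joint4-3 : Joint 2 3
joint4-3 = record
  { left = low (+ 0) ▹ high (+ 4) ▹ low (- + 4) ▹ high (+ 3) ▹ low (- + 3) ▹ ⟪ high (+ 2) ⟫
  ; right = low (+ 2) ▹ high (- + 3) ▹ low (+ 3) ▹ high (- + 4) ▹ low (+ 4) ▹ ⟪ high (+ 0) ⟫
  ; cycle = low (- + 2) ▹ high (+ 1) ▹ low (- + 1) ▹ high (- + 2) ▹ low (+ 1) ▹ ⟪ high (- + 1) ⟫
  ; size = refl
  ; vertices = DecideVertex.decide
  ; rises = DecideRise.decide }

joint5-3 : Joint 3 3
joint5-3 = record
  { left = low (+ 0) ▹ high (- + 2) ▹ low (- + 1) ▹ high (+ 5) ▹ low (- + 5) ▹ high (+ 4) ▹ low (- + 4) ▹ ⟪ high (+ 3) ⟫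
  ; right = low (+ 3) ▹ high (- + 3) ▹ low (+ 1) ▹ high (+ 2) ▹ low (- + 3) ▹ high (+ 1) ▹ low (- + 2) ▹ ⟪ high (+ 0) ⟫
  ; cycle = low (+ 2) ▹ high (- + 5) ▹ low (+ 5) ▹ high (- + 4) ▹ low (+ 4) ▹ ⟪ high (- + 1) ⟫
  ; size = refl
  ; vertices = DecideVertex.decide
  ; rises = DecideRise.decide }

joint6-3 : Joint 4 3
joint6-3 = record
  { left = low (+ 0) ▹ high (- + 1) ▹ low (+ 1) ▹ high (+ 3) ▹ low (- + 5) ▹ high (+ 6) ▹ low (- + 6) ▹ ⟪ high (+ 4) ⟫
  ; right = low (+ 4) ▹ high (- + 3) ▹ low (+ 3) ▹ high (- + 2) ▹ low (+ 2) ▹ high (- + 6) ▹ low (+ 6) ▹ high (- + 5) ▹ low (+ 5) ▹ high (- + 4) ▹ low (- + 1) ▹ ⟪ high (+ 0) ⟫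
  ; cycle = low (- + 4) ▹ high (+ 5) ▹ low (- + 2) ▹ high (+ 1) ▹ low (- + 3) ▹ ⟪ high (+ 2) ⟫
  ; size = refl
  ; vertices = DecideVertex.decide
  ; rises = DecideRise.decide }

joint5-4 : Joint 3 4
joint5-4 = record
  { left = low (+ 0) ▹ high (- + 1) ▹ low (+ 1) ▹ ⟪ high (+ 3) ⟫
  ; right = low (+ 3) ▹ high (- + 3) ▹ low (+ 2) ▹ high (- + 2) ▹ low (+ 5) ▹ high (- + 5) ▹ low (+ 4) ▹ high (- + 4) ▹ low (- + 1) ▹ ⟪ high (+ 0) ⟫
  ; cycle = low (- + 5) ▹ high (+ 5) ▹ low (- + 2) ▹ high (+ 1) ▹ low (- + 3) ▹ high (+ 2) ▹ low (- + 4) ▹ ⟪ high (+ 4) ⟫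
  ; size = refl
  ; vertices = DecideVertex.decide
  ; rises = DecideRise.decide }

joint6-4 : Joint 4 4
joint6-4 = record
  { left = low (+ 0) ▹ high (- + 1) ▹ low (+ 1) ▹ high (- + 2) ▹ low (- + 3) ▹ high (+ 3) ▹ low (- + 2) ▹ high (+ 2) ▹ low (- + 1) ▹ high (+ 1) ▹ low (- + 6) ▹ high (+ 6) ▹ low (- + 5) ▹ high (+ 5) ▹ low (- + 4) ▹ ⟪ high (+ 4) ⟫
  ; right = low (+ 4) ▹ ⟪ high (+ 0) ⟫
  ; cycle = low (+ 2) ▹ high (- + 6) ▹ low (+ 6) ▹ high (- + 5) ▹ low (+ 5) ▹ high (- + 4) ▹ low (+ 3) ▹ ⟪ high (- + 3) ⟫
  ; size = refl
  ; vertices = DecideVertex.decide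
  ; rises = DecideRise.decide }

joint7-4 : Joint 5 4
joint7-4 = record
  { left = low (+ 0) ▹ high (+ 4) ▹ low (- + 5) ▹ high (+ 3) ▹ low (- + 4) ▹ high (+ 2) ▹ low (- + 3) ▹ high (+ 7) ▹ low (- + 7) ▹ high (+ 6) ▹ low (- + 6) ▹ ⟪ high (+ 5) ⟫
  ; right = low (+ 5) ▹ high (- + 1) ▹ low (+ 1) ▹ high (- + 2) ▹ low (+ 2) ▹ high (- + 3) ▹ low (- + 2) ▹ high (+ 1) ▹ low (- + 1) ▹ ⟪ high (+ 0) ⟫
  ; cycle = low (+ 3) ▹ high (- + 7) ▹ low (+ 7) ▹ high (- + 6) ▹ low (+ 6) ▹ high (- + 5) ▹ low (+ 4) ▹ ⟪ high (- + 4) ⟫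
  ; size = refl
  ; vertices = DecideVertex.decide
  ; rises = DecideRise.decide }

joint6-5 : Joint 4 5
joint6-5 = record
  { left = low (+ 0) ▹ high (+ 1) ▹ low (- + 6) ▹ high (+ 6) ▹ low (- + 5) ▹ high (+ 5) ▹ low (- + 4) ▹ ⟪ high (+ 4) ⟫
  ; right = low (+ 4) ▹ high (- + 4) ▹ low (+ 5) ▹ high (- + 5) ▹ low (+ 6) ▹ high (- + 6) ▹ low (+ 1) ▹ ⟪ high (+ 0) ⟫
  ; cycle = low (- + 3) ▹ high (+ 3) ▹ low (- + 2) ▹ high (+ 2) ▹ low (- + 1) ▹ high (- + 3) ▹ low (+ 3) ▹ high (- + 2) ▹ low (+ 2) ▹ ⟪ high (- + 1) ⟫
  ; size = refl
  ; vertices = DecideVertex.decide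
  ; rises = DecideRise.decide }

-- Each arc gains two vertices at either end, so c grows by 4, and the four ends of the arcs are
-- again the labels ±n for the new n = 5 + k. Two new vertices on each half of the path use up the
-- remaining new labels and move the central cut to {high (3 + k), low (3 + k)}.
widen : ∀ {k c} → Open k c → Open (3 + k) (4 + c)
widen {k} {c} T = record
  { left = left ⁀ low (at⁻ 3) ▹ ⟪ high (at⁺ 3) ⟫
  ; right = low (at⁺ 3) ▹ high (at⁻ 3) ▹ right
  ; arc₁ = high (at⁺ 5) ▹ low (at⁻ 2) ▹ arc₁ ⁀ low (at⁺ 4) ▹ ⟪ high (at⁻ 4) ⟫
  ; arc₂ = low (at⁺ 5) ▹ high (at⁻ 2) ▹ arc₂ ⁀ high (at⁺ 4) ▹ ⟪ low (at⁻ 4) ⟫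
  ; size = ≡.trans (cong₂ (λ xs ys → length (high (at⁺ 5) ∷ low (at⁻ 2) ∷ xs ++ low (at⁺ 5) ∷ high (at⁻ 2) ∷ ys)) (verts-⁀ arc₁ _) (verts-⁀ arc₂ _))
      (≡.trans (↭-length (RV.solve 6 (λ x x₁ x₂ y y₁ y₂ → x RV.⊕ (x₁ RV.⊕ x₂) RV.⊕ y RV.⊕ (y₁ RV.⊕ y₂) RV.⊜ (x RV.⊕ x₂ RV.⊕ y RV.⊕ y₂) RV.⊕ x₁ RV.⊕ y₁) ↭-refl
             (high (at⁺ 5) ∷ low (at⁻ 2) ∷ []) (verts arc₁) (low (at⁺ 4) ∷ high (at⁻ 4) ∷ []) (low (at⁺ 5) ∷ high (at⁻ 2) ∷ []) (verts arc₂) (high (at⁺ 4) ∷ low (at⁻ 4) ∷ [])))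
        (cong (λ s → 8 + s) size))
  ; vertices = begin
      verts (left ⁀ _) ++ low (at⁺ 3) ∷ high (at⁻ 3) ∷ verts right ++ high (at⁺ 5) ∷ low (at⁻ 2) ∷ verts (arc₁ ⁀ _) ++ low (at⁺ 5) ∷ high (at⁻ 2) ∷ verts (arc₂ ⁀ _)
        ≡⟨ cong₂ (λ ls (xs , ys) → ls ++ low (at⁺ 3) ∷ high (at⁻ 3) ∷ verts right ++ high (at⁺ 5) ∷ low (at⁻ 2) ∷ xs ++ low (at⁺ 5) ∷ high (at⁻ 2) ∷ ys) (verts-⁀ left _) (cong₂ _,_ (verts-⁀ arc₁ _) (verts-⁀ arc₂ _)) ⟩
      (verts left ++ low (at⁻ 3) ∷ high (at⁺ 3) ∷ []) ++ low (at⁺ 3) ∷ high (at⁻ 3) ∷ verts right ++ high (at⁺ 5) ∷ low (at⁻ 2) ∷ (verts arc₁ ++ low (at⁺ 4) ∷ high (at⁻ 4) ∷ []) ++ low (at⁺ 5) ∷ high (at⁻ 2) ∷ (verts arc₂ ++ high (at⁺ 4) ∷ low (at⁻ 4) ∷ [])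
        ↭⟨ regroupV (verts left) (low (at⁻ 3) ∷ high (at⁺ 3) ∷ []) (low (at⁺ 3) ∷ high (at⁻ 3) ∷ []) (verts right) (high (at⁺ 5) ∷ low (at⁻ 2) ∷ []) (verts arc₁) (low (at⁺ 4) ∷ high (at⁻ 4) ∷ []) (low (at⁺ 5) ∷ high (at⁻ 2) ∷ []) (verts arc₂) (high (at⁺ 4) ∷ low (at⁻ 4) ∷ []) ⟩
      map (at k) newV ++ verts left ++ verts right ++ verts arc₁ ++ verts arc₂
        ↭⟨ ++⁺ (map⁺ (at k) (DecideCorner.decide {xs = newV} {ys = map low (layers 2 3) ++ map high (layers 2 3)})) vertices ⟩
      map (at k) (map low (layers 2 3) ++ map high (layers 2 3)) ++ square (2 + k)
        ↭⟨ RV.solve 4 (λ l h l′ h′ → (l RV.⊕ h) RV.⊕ l′ RV.⊕ h′ RV.⊜ (l RV.⊕ l′) RV.⊕ h RV.⊕ h′) ↭-refl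
             (map (at k) (map low (layers 2 3))) (map (at k) (map high (layers 2 3))) (map low (shells (0ℤ ∷ []) (2 + k))) (map high (shells (0ℤ ∷ []) (2 + k))) ⟩
      square (5 + k) ∎
  ; rises = begin
      map rise (edges (left ⁀ _) ++ _ ∷ _ ∷ edges right ++ _ ∷ _ ∷ edges (arc₁ ⁀ _) ++ _ ∷ _ ∷ edges (arc₂ ⁀ _))
        ≡⟨ cong₂ (λ ls (xs , ys) → map rise (ls ++ r₁ ∷ r₂ ∷ edges right ++ x₁ ∷ x₂ ∷ xs ++ y₁ ∷ y₂ ∷ ys)) (edges-⁀ left _) (cong₂ _,_ (edges-⁀ arc₁ _) (edges-⁀ arc₂ _)) ⟩
      map rise ((edges left ++ l₁ ∷ l₂ ∷ []) ++ r₁ ∷ r₂ ∷ edges right ++ x₁ ∷ x₂ ∷ (edges arc₁ ++ x₃ ∷ x₄ ∷ []) ++ y₁ ∷ y₂ ∷ (edges arc₂ ++ y₃ ∷ y₄ ∷ []))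
        ↭⟨ map⁺ rise (regroupE (edges left) (l₁ ∷ l₂ ∷ []) (r₁ ∷ r₂ ∷ []) (edges right) (x₁ ∷ x₂ ∷ []) (edges arc₁) (x₃ ∷ x₄ ∷ []) (y₁ ∷ y₂ ∷ []) (edges arc₂) (y₃ ∷ y₄ ∷ [])) ⟩
      map rise (map (map² (at k)) newE) ++ map rise (edges left ++ edges right ++ edges arc₁ ++ edges arc₂)
        ≡⟨ cong (_++ map rise (edges left ++ edges right ++ edges arc₁ ++ edges arc₂)) (rises-at k newE {mapMaybe cross newE} refl) ⟩
      map just (map (dbl k ⟦_⟧) (mapMaybe cross newE)) ++ map rise (edges left ++ edges right ++ edges arc₁ ++ edges arc₂)
        -- The new edges start with the rises ±(4 + 2k), given up by the old cut edges, and stop at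
        -- ±(9 + 2k), leaving ±(10 + 2k) to the new cut edges.
        ↭⟨ ++⁺ (map⁺ just (map⁺ (dbl k ⟦_⟧) (DecideOffset.decide {xs = mapMaybe cross newE} {ys = layers 3 6}))) rises ⟩
      map just (shells [] (9 + dbl k)) ∎ }
  where
  open Open T
  open PermutationReasoning
  module RV = Rearrange (Vertex ℤ)
  module RE = Rearrange (Vertex ℤ × Vertex ℤ)
  at⁺ at⁻ : ℕ → ℤ
  at⁺ b = k ⟦ pos b ⟧
  at⁻ b = k ⟦ neg b ⟧
  newV : List (Vertex Offset)
  newV = low (neg 3) ∷ high (pos 3) ∷ low (pos 3) ∷ high (neg 3)
       ∷ high (pos 5) ∷ low (neg 2) ∷ low (pos 4) ∷ high (neg 4)
       ∷ low (pos 5) ∷ high (neg 2) ∷ high (pos 4) ∷ low (neg 4) ∷ []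
  newE : List (Vertex Offset × Vertex Offset)
  newE = (high (pos 0) , low (neg 3)) ∷ (low (neg 3) , high (pos 3))
       ∷ (low (pos 3) , high (neg 3)) ∷ (high (neg 3) , low (pos 0))
       ∷ (high (pos 5) , low (neg 2)) ∷ (low (neg 2) , high (pos 2))
       ∷ (high (neg 1) , low (pos 4)) ∷ (low (pos 4) , high (neg 4))
       ∷ (low (pos 5) , high (neg 2)) ∷ (high (neg 2) , low (pos 2))
       ∷ (low (neg 1) , high (pos 4)) ∷ (high (pos 4) , low (neg 4)) ∷ []
  l₁ l₂ r₁ r₂ x₁ x₂ x₃ x₄ y₁ y₂ y₃ y₄ : Vertex ℤ × Vertex ℤ
  l₁ = high (at⁺ 0) , low (at⁻ 3)
  l₂ = low (at⁻ 3) , high (at⁺ 3)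
  r₁ = low (at⁺ 3) , high (at⁻ 3)
  r₂ = high (at⁻ 3) , low (at⁺ 0)
  x₁ = high (at⁺ 5) , low (at⁻ 2)
  x₂ = low (at⁻ 2) , high (at⁺ 2)
  x₃ = high (at⁻ 1) , low (at⁺ 4)
  x₄ = low (at⁺ 4) , high (at⁻ 4)
  y₁ = low (at⁺ 5) , high (at⁻ 2)
  y₂ = high (at⁻ 2) , low (at⁺ 2)
  y₃ = low (at⁻ 1) , high (at⁺ 4)
  y₄ = high (at⁺ 4) , low (at⁻ 4)
  regroup : ∀ {A : Set} (l l′ r′ r x′ x x″ y′ y y″ : List A) →
    (l ++ l′) ++ r′ ++ r ++ x′ ++ (x ++ x″) ++ y′ ++ (y ++ y″) ↭ (l′ ++ r′ ++ x′ ++ x″ ++ y′ ++ y″) ++ l ++ r ++ x ++ y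
  regroup {A} = solve 10 (λ l l′ r′ r x′ x x″ y′ y y″ →
    (l ⊕ l′) ⊕ r′ ⊕ r ⊕ x′ ⊕ (x ⊕ x″) ⊕ y′ ⊕ (y ⊕ y″) ⊜ (l′ ⊕ r′ ⊕ x′ ⊕ x″ ⊕ y′ ⊕ y″) ⊕ l ⊕ r ⊕ x ⊕ y) ↭-refl
    where open Rearrange A
  regroupV = regroup {Vertex ℤ}
  regroupE = regroup {Vertex ℤ × Vertex ℤ}

-- Joining the arcs restores the two cut edges, whose rises ±2n form the outermost shell.
seal : ∀ {k c} → Open k c → Joint k c
seal {k} {c} T = record
  { left = left
  ; right = right
  ; cycle = arc₁ ⁀ arc₂
  ; size = ≡.trans (cong length (verts-⁀ arc₁ arc₂)) size
  ; vertices = subst (λ vs → verts left ++ verts right ++ vs ↭ square (2 + k)) (sym (verts-⁀ arc₁ arc₂)) vertices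
  ; rises = begin
      map rise (edges left ++ edges right ++ (low -[1+ 1 + k ] , high (+ (2 + k))) ∷ edges (arc₁ ⁀ arc₂))
        ≡⟨ cong (λ es → map rise (edges left ++ edges right ++ (low -[1+ 1 + k ] , high (+ (2 + k))) ∷ es)) (edges-⁀ arc₁ arc₂) ⟩
      map rise (edges left ++ edges right ++ (low -[1+ 1 + k ] , high (+ (2 + k))) ∷ edges arc₁ ++ (high -[1+ 1 + k ] , low (+ (2 + k))) ∷ edges arc₂)
        ↭⟨ map⁺ rise (solve 6 (λ l r p x q y → l ⊕ r ⊕ p ⊕ x ⊕ q ⊕ y ⊜ p ⊕ q ⊕ l ⊕ r ⊕ x ⊕ y) ↭-refl
             (edges left) (edges right) (_ ∷ []) (edges arc₁) (_ ∷ []) (edges arc₂)) ⟩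
      map rise (map (map² (at k)) ends) ++ map rise (edges left ++ edges right ++ edges arc₁ ++ edges arc₂)
        ≡⟨ cong (_++ map rise (edges left ++ edges right ++ edges arc₁ ++ edges arc₂)) (rises-at k ends {pos 4 ∷ neg 3 ∷ []} refl) ⟩
      just (+ (4 + dbl k)) ∷ just -[1+ 3 + dbl k ] ∷ map rise (edges left ++ edges right ++ edges arc₁ ++ edges arc₂)
        ↭⟨ prep _ (prep _ rises) ⟩
      map just (shells [] (dbl (2 + k))) ∎ }
  where
  open Open T
  open PermutationReasoning
  open Rearrange (Vertex ℤ × Vertex ℤ)
  ends : List (Vertex Offset × Vertex Offset)
  ends = (low (neg 1) , high (pos 2)) ∷ (high (neg 1) , low (pos 2)) ∷ []

-- Tilings for all 2 ≤ c < n

grow : ∀ d {k c} → Joint k c → Joint (3 + d + k) c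
grow 0 = grow3
grow 1 = grow4
grow 2 = grow5
grow (suc (suc (suc d))) T = grow3 (grow d T)

-- The joint has n = 2 + k, and every increment of at least 3 is 3, 4 or 5 plus a multiple of 3.
reach : ∀ {k c n} → Joint k c → 5 + k ≤ n → Tiling n c
reach {k} {c} {n} T 5+k≤n = subst (λ m → Tiling m c) eq (close (grow (n ∸ (5 + k)) T))
  where
  lemma : ∀ d k → 2 + (3 + d + k) ≡ d + (5 + k)
  lemma = solve-∀
  eq : 2 + (3 + (n ∸ (5 + k)) + k) ≡ n
  eq = ≡.trans (lemma (n ∸ (5 + k)) k) (ℕ.m∸n+n≡m 5+k≤n)

-- The bound on k leaves room to grow to every n > c.
wide : ∀ m → ∃ λ k → k ≤ 2 + m × Open k (6 + m)
wide 0 = _ , ℕ.m≤m+n _ _ , core4-6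
wide 1 = _ , ℕ.m≤m+n _ _ , core4-7
wide 2 = _ , ℕ.m≤m+n _ _ , core5-8
wide 3 = _ , ℕ.m≤m+n _ _ , widen core4-5
wide (suc (suc (suc (suc m)))) with wide m
-- Widening adds 4 to c but only 3 to k, so the bound on k persists.
... | k , k≤ , T = 3 + k , ℕ.m≤n⇒m≤1+n (ℕ.+-monoʳ-≤ 3 k≤) , widen T

-- Here d counts how far n exceeds its least value. For cycles of length 4, 6 and 8 the three least
-- n are explicit and the rest grow from the first. For length 10 growth starts at n = 4, below the
-- least admissible n = 6, so it already covers n = 7. Longer cycles come from `wide`.
tiling : ∀ c d → Tiling (3 + c + d) (2 + c)
tiling 0 0 = close joint3-2
tiling 0 1 = close joint4-2
tiling 0 2 = close joint5-2
tiling 0 (suc (suc (suc d))) = reach joint3-2 (ℕ.m≤m+n 6 d)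
tiling 1 0 = close joint4-3
tiling 1 1 = close joint5-3
tiling 1 2 = close joint6-3
tiling 1 (suc (suc (suc d))) = reach joint4-3 (ℕ.m≤m+n 7 d)
tiling 2 0 = close joint5-4
tiling 2 1 = close joint6-4
tiling 2 2 = close joint7-4
tiling 2 (suc (suc (suc d))) = reach joint5-4 (ℕ.m≤m+n 8 d)
tiling 3 0 = close joint6-5
tiling 3 (suc d) = reach (seal core4-5) (ℕ.m≤m+n 7 d)
tiling (suc (suc (suc (suc m)))) d with wide m
... | k , k≤ , T = reach (seal T) (ℕ.+-monoʳ-≤ 5 (ℕ.≤-trans k≤ (ℕ.+-monoʳ-≤ 2 (ℕ.m≤m+n m d))))

concatMap⁺ : (f : A → List B) {xs ys : List A} → xs ↭ ys → concatMap f xs ↭ concatMap f ys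
concatMap⁺ f refl = ↭-refl
concatMap⁺ f (prep x p) = ++⁺ˡ (f x) (concatMap⁺ f p)
concatMap⁺ f (swap x y p) = ↭-trans (shifts (f x) (f y)) (++⁺ˡ (f y) (++⁺ˡ (f x) (concatMap⁺ f p)))
concatMap⁺ f (trans p q) = ↭-trans (concatMap⁺ f p) (concatMap⁺ f q)

-- Runs of consecutive integers

-- Given by start and length rather than by two ends, so that splitting and translating follow the
-- recursion.
run : ℕ → ℕ → List ℤ
run s zero = []
run s (suc l) = + s ∷ run (suc s) l

run-++ : ∀ s l m → run s (l + m) ≡ run s l ++ run (s + l) m
run-++ s zero m = cong (λ t → run t m) (sym (ℕ.+-identityʳ s))
run-++ s (suc l) m = cong (+ s ∷_) (≡.trans (run-++ (suc s) l m) (cong (λ t → run (suc s) l ++ run t m) (sym (ℕ.+-suc s l))))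

applyUpTo-run : ∀ (f : ℕ → ℤ) s l → (∀ i → f i ≡ + (s + i)) → applyUpTo f l ≡ run s l
applyUpTo-run f s zero eq = refl
applyUpTo-run f s (suc l) eq = cong₂ _∷_ (≡.trans (eq 0) (cong +_ (ℕ.+-identityʳ s)))
  (applyUpTo-run (f ∘ suc) (suc s) l (λ i → ≡.trans (eq (suc i)) (cong +_ (ℕ.+-suc s i))))

interval-run : ∀ s t → interval s t ≡ run s (suc t ∸ s)
interval-run s t = ≡.trans (map-upTo _ (suc t ∸ s)) (applyUpTo-run _ s (suc t ∸ s) (λ _ → refl))

translate : ℕ → ℤ → ℤ
translate t z = z ℤ.+ + t

translate-run : ∀ t s l → map (translate t) (run s l) ≡ run (s + t) l
translate-run t s zero = refl
translate-run t s (suc l) = cong (_ ∷_) (translate-run t (suc s) l)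

-- By induction on m: the outermost shell lands on the last and first entries of the run, and the
-- inner shells fill the run between them, which starts at `suc s`.
translate-shells : ∀ m s → map (translate (m + s)) (shells (0ℤ ∷ []) m) ↭ run s (suc (m + m))
translate-shells zero s = ↭-refl
translate-shells (suc m) s = begin
  + (suc m + suc (m + s)) ∷ (-[1+ m ] ℤ.+ + suc (m + s)) ∷ map (translate (suc m + s)) (shells (0ℤ ∷ []) m)
    ≡⟨ cong₂ (λ x y → + x ∷ y ∷ map (translate (suc m + s)) (shells (0ℤ ∷ []) m)) (top m s) (bottom m s) ⟩
  + (suc s + suc (m + m)) ∷ + s ∷ map (translate (suc m + s)) (shells (0ℤ ∷ []) m)
    ≡⟨ cong (λ t → + (suc s + suc (m + m)) ∷ + s ∷ map (translate t) (shells (0ℤ ∷ []) m)) (ℕ.+-suc m s) ⟨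
  + (suc s + suc (m + m)) ∷ + s ∷ map (translate (m + suc s)) (shells (0ℤ ∷ []) m)
    ↭⟨ prep _ (prep _ (translate-shells m (suc s))) ⟩
  + (suc s + suc (m + m)) ∷ + s ∷ run (suc s) (suc (m + m))
    ↭⟨ ++-comm (+ (suc s + suc (m + m)) ∷ []) (+ s ∷ run (suc s) (suc (m + m))) ⟩
  + s ∷ run (suc s) (suc (m + m)) ++ run (suc s + suc (m + m)) 1
    ≡⟨ cong (+ s ∷_) (run-++ (suc s) (suc (m + m)) 1) ⟨
  + s ∷ run (suc s) (suc (m + m) + 1)
    ≡⟨ cong (λ l → + s ∷ run (suc s) l) (count m) ⟩
  run s (suc (suc m + suc m)) ∎
  where
  open PermutationReasoning
  top : ∀ m s → suc m + suc (m + s) ≡ suc s + suc (m + m)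
  top = solve-∀
  bottom : ∀ m s → -[1+ m ] ℤ.+ + suc (m + s) ≡ + s
  bottom m s = ≡.trans (ℤ.[1+m]⊖[1+n]≡m⊖n (m + s) m) (≡.trans (cong (ℤ._⊖ m) (ℕ.+-comm m s))
    (≡.trans (ℤ.⊖-≥ (ℕ.m≤n+m m s)) (cong +_ (ℕ.m+n∸n≡m s m))))
  count : ∀ m → suc (m + m) + 1 ≡ suc m + suc m
  count = solve-∀

-- Walks and the lists of adjacent pairs

pairs-verts : (w : Walk {ℤ} a b) → pairs (verts w) ≡ edges w
pairs-verts ⟪ a ⟫ = refl
pairs-verts (a ▹ ⟪ b ⟫) = refl
pairs-verts (a ▹ b ▹ w) = cong (_ ∷_) (pairs-verts (b ▹ w))

cycleEdges-verts : (w : Walk {ℤ} a b) → cycleEdges (verts w) ≡ edges w ++ (b , a) ∷ []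
cycleEdges-verts {a} {b} w = begin
  cycleEdges (verts w)             ≡⟨ open-up w ⟩
  pairs (verts w ++ a ∷ [])        ≡⟨ cong pairs (verts-⁀ w ⟪ a ⟫) ⟨
  pairs (verts (w ⁀ ⟪ a ⟫))        ≡⟨ pairs-verts (w ⁀ ⟪ a ⟫) ⟩
  edges (w ⁀ ⟪ a ⟫)                ≡⟨ edges-⁀ w ⟪ a ⟫ ⟩
  edges w ++ (b , a) ∷ [] ∎
  where
  open ≡-Reasoning
  open-up : ∀ {a b} (w : Walk {ℤ} a b) → cycleEdges (verts w) ≡ pairs (verts w ++ a ∷ [])
  open-up ⟪ _ ⟫ = refl
  open-up (_ ▹ _) = refl

pairs-map : ∀ f vs → pairs (map f vs) ≡ map (map² f) (pairs vs)
pairs-map f [] = refl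
pairs-map f (_ ∷ []) = refl
pairs-map f (u ∷ v ∷ vs) = cong (_ ∷_) (pairs-map f (v ∷ vs))

cycleEdges-map : ∀ f vs → cycleEdges (map f vs) ≡ map (map² f) (cycleEdges vs)
cycleEdges-map f [] = refl
cycleEdges-map f (v ∷ vs) = ≡.trans (cong (λ us → pairs (f v ∷ us)) (sym (map-++ f vs (v ∷ []))))
  (pairs-map f (v ∷ vs ++ v ∷ []))

head-verts : (w : Walk {A} a b) → head (verts w) ≡ just a
head-verts ⟪ _ ⟫ = refl
head-verts (_ ▹ _) = refl

last-verts : (w : Walk {A} a b) → last (verts w) ≡ just b
last-verts ⟪ _ ⟫ = refl
last-verts (_ ▹ ⟪ _ ⟫) = refl
last-verts (_ ▹ b ▹ w) = last-verts (b ▹ w)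

-- Differences

-- The interleaved counterpart of `pm`: it matches the order of `edgeDiffs` and lets `concatMap`
-- distribute over `++`.
± : ℤ → List ℤ
± d = d ∷ - d ∷ []

concatMap-± : ∀ xs → concatMap ± xs ↭ pm xs
concatMap-± [] = ↭-refl
concatMap-± (x ∷ xs) = prep x (begin
  - x ∷ concatMap ± xs        ↭⟨ prep (- x) (concatMap-± xs) ⟩
  - x ∷ xs ++ map -_ xs       ↭⟨ shifts (- x ∷ []) xs ⟩
  xs ++ - x ∷ map -_ xs ∎)
  where open PermutationReasoning

edgeDiffs-translate : ∀ t es → concatMap edgeDiffs (map (map² (translate t)) es) ≡ concatMap edgeDiffs es
edgeDiffs-translate t es = ≡.trans (concatMap-map edgeDiffs _ es)
  (concatMap-cong (λ (u , v) → cong₂ (λ x y → x ∷ y ∷ []) (cancel u v (+ t)) (cancel v u (+ t))) es)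
  where
  cancel : ∀ u v w → (u ℤ.+ w) ℤ.- (v ℤ.+ w) ≡ u ℤ.- v
  cancel = ℤ-Solver.solve-∀

-- Placing a tiling around a labeling

label : ℕ → ℕ → Vertex ℤ → ℤ
label n q (low x) = translate n x
label n q (high y) = translate (n + q) y

high-low : ∀ x y n q → (y ℤ.+ (n ℤ.+ q)) ℤ.- (x ℤ.+ n) ≡ (y ℤ.- x) ℤ.+ q
high-low = ℤ-Solver.solve-∀

low-high : ∀ x y n q → (x ℤ.+ n) ℤ.- (y ℤ.+ (n ℤ.+ q)) ≡ - ((y ℤ.- x) ℤ.+ q)
low-high = ℤ-Solver.solve-∀

-- The high group lies q further up than the low group, so a rise d becomes the difference d + q.
-- The hypothesis leaves only low-high edges to consider.
edgeDiffs-label : ∀ n q es ds → map rise es ≡ map just ds →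
  concatMap edgeDiffs (map (map² (label n q)) es) ↭ concatMap ± (map (translate q) ds)
edgeDiffs-label n q [] [] _ = ↭-refl
edgeDiffs-label n q ((low x , high y) ∷ es) (d ∷ ds) eq with ∷-injective eq
... | refl , eq′ = ↭-trans (swap _ _ (edgeDiffs-label n q es ds eq′))
  (↭-reflexive (cong₂ (λ u v → u ∷ v ∷ concatMap ± (map (translate q) ds)) (high-low x y (+ n) (+ q)) (low-high x y (+ n) (+ q))))
edgeDiffs-label n q ((high y , low x) ∷ es) (d ∷ ds) eq with ∷-injective eq
... | refl , eq′ = ↭-trans (prep _ (prep _ (edgeDiffs-label n q es ds eq′)))
  (↭-reflexive (cong₂ (λ u v → u ∷ v ∷ concatMap ± (map (translate q) ds)) (high-low x y (+ n) (+ q)) (low-high x y (+ n) (+ q))))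

-- The induction form of `GL` for exactly one 2-cycle, with ε = 3 + e: the differences are 1, 3, 3
-- and e further ones from 4 on.
record Labeling (Ls : List ℕ) (e : ℕ) (x y : ℤ) : Set where
  field
    cycles : List (List ℤ)
    path : Walk x y
    lengths : map length cycles ≡ Ls
    vertices : concat cycles ++ verts path ↭ run 0 (4 + e)
    differences : concatMap edgeDiffs (concat (map cycleEdges cycles) ++ edges path) ↭
                  concatMap ± (+ 1 ∷ + 3 ∷ + 3 ∷ run 4 e)

cyclesEdges-map : ∀ f vss → concat (map cycleEdges (map (map f) vss)) ≡ map (map² f) (concat (map cycleEdges vss))
cyclesEdges-map f [] = refl
cyclesEdges-map f (vs ∷ vss) = ≡.trans (cong₂ _++_ (cycleEdges-map f vs) (cyclesEdges-map f vss))
  (sym (map-++ (map² f) (cycleEdges vs) _))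

-- The groups lie q = N + 4 + e apart, so the rises -2n, ..., 2n become 5 + e, ..., 5 + e + 4n, and
-- the link to the old path supplies 4 + e: together the next 2N differences. The new path starts at
-- low 0, which is label n again, so the step can be repeated.
enclose : ∀ {n c Ls e y} → let N = suc (n + n) in
  Tiling n c → Labeling Ls e (+ n) (+ y) → Labeling (dbl c ∷ Ls) (e + (N + N)) (+ n) (+ (y + N))
enclose {n} {c} {Ls} {e} {y} T Γ = record
  { cycles = map l (verts T.cycle) ∷ map (map t) Γ.cycles
  ; path = mapWalk l T.path ⁀ mapWalk t Γ.path
  ; lengths = cong₂ _∷_ (≡.trans (length-map l (verts T.cycle)) T.size)
      (≡.trans (sym (map-∘ Γ.cycles)) (≡.trans (map-cong (length-map t) Γ.cycles) Γ.lengths))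
  ; vertices = begin
      (map l (verts T.cycle) ++ concat (map (map t) Γ.cycles)) ++ verts (mapWalk l T.path ⁀ mapWalk t Γ.path)
        ≡⟨ cong₂ (λ xs ys → (map l (verts T.cycle) ++ xs) ++ ys) (concat-map Γ.cycles)
             (≡.trans (verts-⁀ (mapWalk l T.path) (mapWalk t Γ.path)) (cong₂ _++_ (verts-map l T.path) (verts-map t Γ.path))) ⟩
      (map l (verts T.cycle) ++ map t (concat Γ.cycles)) ++ map l (verts T.path) ++ map t (verts Γ.path)
        ↭⟨ RZ.solve 4 (λ c cs p q → (c RZ.⊕ cs) RZ.⊕ p RZ.⊕ q RZ.⊜ (p RZ.⊕ c) RZ.⊕ cs RZ.⊕ q) ↭-refl
             (map l (verts T.cycle)) (map t (concat Γ.cycles)) (map l (verts T.path)) (map t (verts Γ.path)) ⟩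
      (map l (verts T.path) ++ map l (verts T.cycle)) ++ map t (concat Γ.cycles) ++ map t (verts Γ.path)
        ≡⟨ cong₂ _++_ (map-++ l (verts T.path) _) (map-++ t (concat Γ.cycles) _) ⟨
      map l (verts T.path ++ verts T.cycle) ++ map t (concat Γ.cycles ++ verts Γ.path)
        ↭⟨ ++⁺ (map⁺ l T.vertices) (map⁺ t Γ.vertices) ⟩
      map l (map low S ++ map high S) ++ map t (run 0 (4 + e))
        ≡⟨ cong₂ _++_ (≡.trans (map-++ l (map low S) _) (cong₂ _++_ (sym (map-∘ S)) (sym (map-∘ S)))) (translate-run N 0 (4 + e)) ⟩
      (map (translate n) S ++ map (translate (n + (N + (4 + e)))) S) ++ run N (4 + e)
        ↭⟨ ++⁺ʳ (run N (4 + e)) (++⁺ lows (translate-shells n (N + (4 + e)))) ⟩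
      (run 0 N ++ run (N + (4 + e)) N) ++ run N (4 + e)
        ↭⟨ RZ.solve 3 (λ a b c → (a RZ.⊕ b) RZ.⊕ c RZ.⊜ a RZ.⊕ c RZ.⊕ b) ↭-refl (run 0 N) (run (N + (4 + e)) N) (run N (4 + e)) ⟩
      run 0 N ++ run N (4 + e) ++ run (N + (4 + e)) N
        ≡⟨ ≡.trans (run-++ 0 N ((4 + e) + N)) (cong (run 0 N ++_) (run-++ N (4 + e) N)) ⟨
      run 0 (N + ((4 + e) + N))
        ≡⟨ cong (run 0) (vertex-count N e) ⟩
      run 0 (4 + (e + (N + N))) ∎
  ; differences = begin
      concatMap edgeDiffs ((cycleEdges (map l (verts T.cycle)) ++ concat (map cycleEdges (map (map t) Γ.cycles))) ++ edges (mapWalk l T.path ⁀ mapWalk t Γ.path))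
        ≡⟨ cong₂ (λ xs ys → concatMap edgeDiffs (xs ++ ys))
             (cong₂ _++_ new-cycle (cyclesEdges-map t Γ.cycles))
             (≡.trans (edges-⁀ (mapWalk l T.path) (mapWalk t Γ.path)) (cong₂ (λ xs ys → xs ++ link ∷ ys) (edges-map l T.path) (edges-map t Γ.path))) ⟩
      concatMap edgeDiffs (((map (map² l) (edges T.cycle) ++ map² l (T.end , T.start) ∷ []) ++ map (map² t) cs) ++ map (map² l) (edges T.path) ++ link ∷ map (map² t) (edges Γ.path))
        ↭⟨ concatMap⁺ edgeDiffs (RE.solve 6 (λ c x cs p k q → ((c RE.⊕ x) RE.⊕ cs) RE.⊕ p RE.⊕ k RE.⊕ q RE.⊜ k RE.⊕ (p RE.⊕ x RE.⊕ c) RE.⊕ cs RE.⊕ q) ↭-refl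
             (map (map² l) (edges T.cycle)) (_ ∷ []) (map (map² t) cs) (map (map² l) (edges T.path)) (link ∷ []) (map (map² t) (edges Γ.path))) ⟩
      concatMap edgeDiffs (link ∷ (map (map² l) (edges T.path) ++ map (map² l) (loop T.cycle)) ++ map (map² t) cs ++ map (map² t) (edges Γ.path))
        ≡⟨ cong₂ (λ xs ys → concatMap edgeDiffs (link ∷ xs ++ ys)) (map-++ (map² l) (edges T.path) (loop T.cycle)) (map-++ (map² t) cs (edges Γ.path)) ⟨
      edgeDiffs link ++ concatMap edgeDiffs (map (map² l) (edges T.path ++ loop T.cycle) ++ map (map² t) (cs ++ edges Γ.path))
        ≡⟨ cong₂ _++_ link-diffs (concatMap-++ edgeDiffs (map (map² l) (edges T.path ++ loop T.cycle)) _) ⟩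
      ± (+ (4 + e)) ++ concatMap edgeDiffs (map (map² l) (edges T.path ++ loop T.cycle)) ++ concatMap edgeDiffs (map (map² t) (cs ++ edges Γ.path))
        ↭⟨ ++⁺ˡ (± (+ (4 + e))) (++⁺ new (↭-trans (↭-reflexive (edgeDiffs-translate N (cs ++ edges Γ.path))) Γ.differences)) ⟩
      ± (+ (4 + e)) ++ concatMap ± (run (5 + e) (suc (dbl n + dbl n))) ++ concatMap ± (+ 1 ∷ + 3 ∷ + 3 ∷ run 4 e)
        ↭⟨ RZ.solve 3 (λ a b c → a RZ.⊕ b RZ.⊕ c RZ.⊜ c RZ.⊕ a RZ.⊕ b) ↭-refl (± (+ (4 + e))) (concatMap ± (run (5 + e) (suc (dbl n + dbl n)))) (concatMap ± (+ 1 ∷ + 3 ∷ + 3 ∷ run 4 e)) ⟩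
      concatMap ± (+ 1 ∷ + 3 ∷ + 3 ∷ run 4 e) ++ concatMap ± (run (4 + e) (2 + (dbl n + dbl n)))
        ≡⟨ concatMap-++ ± (+ 1 ∷ + 3 ∷ + 3 ∷ run 4 e) _ ⟨
      concatMap ± (+ 1 ∷ + 3 ∷ + 3 ∷ run 4 e ++ run (4 + e) (2 + (dbl n + dbl n)))
        ≡⟨ cong (λ xs → concatMap ± (+ 1 ∷ + 3 ∷ + 3 ∷ xs)) (run-++ 4 e _) ⟨
      concatMap ± (+ 1 ∷ + 3 ∷ + 3 ∷ run 4 (e + (2 + (dbl n + dbl n))))
        ≡⟨ cong (λ m → concatMap ± (+ 1 ∷ + 3 ∷ + 3 ∷ run 4 (e + m))) (≡.trans (cong₂ (λ a b → 2 + (a + b)) (dbl-+ n) (dbl-+ n)) (rise-count n)) ⟩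
      concatMap ± (+ 1 ∷ + 3 ∷ + 3 ∷ run 4 (e + (N + N))) ∎ }
  where
  module T = Tiling T
  module Γ = Labeling Γ
  open PermutationReasoning
  module RZ = Rearrange ℤ
  module RE = Rearrange (ℤ × ℤ)
  N = suc (n + n)
  S = shells (0ℤ ∷ []) n
  l = label n (N + (4 + e))
  t = translate N
  cs = concat (map cycleEdges Γ.cycles)
  link : ℤ × ℤ
  link = + (n + (N + (4 + e))) , + (n + N)
  new-cycle : cycleEdges (map l (verts T.cycle)) ≡ map (map² l) (edges T.cycle) ++ map² l (T.end , T.start) ∷ []
  new-cycle = ≡.trans (cong cycleEdges (sym (verts-map l T.cycle)))
    (≡.trans (cycleEdges-verts (mapWalk l T.cycle)) (cong (_++ map² l (T.end , T.start) ∷ []) (edges-map l T.cycle)))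
  lows : map (translate n) S ↭ run 0 N
  lows = subst (λ m → map (translate m) S ↭ run 0 N) (ℕ.+-identityʳ n) (translate-shells n 0)
  vertex-count : ∀ N e → N + ((4 + e) + N) ≡ 4 + (e + (N + N))
  vertex-count = solve-∀
  rise-count : ∀ n → 2 + ((n + n) + (n + n)) ≡ suc (n + n) + suc (n + n)
  rise-count = solve-∀
  rise-offset : ∀ n e → suc (n + n) + (4 + e) ≡ (n + n) + (5 + e)
  rise-offset = solve-∀
  link-diffs : edgeDiffs link ≡ ± (+ (4 + e))
  link-diffs = cong₂ (λ u v → u ∷ v ∷ []) (fwd (+ n) (+ N) (+ (4 + e))) (bwd (+ n) (+ N) (+ (4 + e)))
    where
    fwd : ∀ a b c → (a ℤ.+ (b ℤ.+ c)) ℤ.- (a ℤ.+ b) ≡ c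
    fwd = ℤ-Solver.solve-∀
    bwd : ∀ a b c → (a ℤ.+ b) ℤ.- (a ℤ.+ (b ℤ.+ c)) ≡ - c
    bwd = ℤ-Solver.solve-∀
  new : concatMap edgeDiffs (map (map² l) (edges T.path ++ loop T.cycle)) ↭ concatMap ± (run (5 + e) (suc (dbl n + dbl n)))
  -- Pulling the permutation back along `just` gives the integer rises `ds` in the order of the
  -- edges.
  new with ↭-map-inv just (↭-sym T.rises)
  ... | ds , eq , p = begin
    concatMap edgeDiffs (map (map² l) (edges T.path ++ loop T.cycle))
      ↭⟨ edgeDiffs-label n (N + (4 + e)) (edges T.path ++ loop T.cycle) ds eq ⟩
    concatMap ± (map (translate (N + (4 + e))) ds)
      ↭⟨ concatMap⁺ ± (map⁺ (translate (N + (4 + e))) p) ⟨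
    concatMap ± (map (translate (N + (4 + e))) (shells (0ℤ ∷ []) (dbl n)))
      ≡⟨ cong (λ q → concatMap ± (map (translate q) (shells (0ℤ ∷ []) (dbl n)))) (≡.trans (rise-offset n e) (cong (_+ (5 + e)) (sym (dbl-+ n)))) ⟩
    concatMap ± (map (translate (dbl n + (5 + e))) (shells (0ℤ ∷ []) (dbl n)))
      ↭⟨ concatMap⁺ ± (translate-shells (dbl n) (5 + e)) ⟩
    concatMap ± (run (5 + e) (suc (dbl n + dbl n))) ∎

-- The innermost labeling

data _spans_ : ℤ × ℤ → ℕ → Set where
  fall : ∀ {u v x} → u ≡ x + v → (+ u , + v) spans x
  climb : ∀ {u v x} → v ≡ x + u → (+ u , + v) spans x

[x+v]-v : ∀ x v → (x ℤ.+ v) ℤ.- v ≡ x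
[x+v]-v = ℤ-Solver.solve-∀

v-[x+v] : ∀ x v → v ℤ.- (x ℤ.+ v) ≡ - x
v-[x+v] = ℤ-Solver.solve-∀

-- Reduces differences of edges to equations between naturals, most of which hold by `refl` for the
-- edges below, whichever way an edge is directed.
edgeDiffs-spans : ∀ es xs → Pointwise _spans_ es xs → concatMap edgeDiffs es ↭ concatMap ± (map +_ xs)
edgeDiffs-spans [] [] [] = ↭-refl
edgeDiffs-spans (_ ∷ es) (x ∷ xs) (fall {_} {v} refl ∷ ps) = ↭-trans
  (↭-reflexive (cong₂ (λ a b → a ∷ b ∷ _) ([x+v]-v (+ x) (+ v)) (v-[x+v] (+ x) (+ v))))
  (prep _ (prep _ (edgeDiffs-spans es xs ps)))
edgeDiffs-spans (_ ∷ es) (x ∷ xs) (climb {u} refl ∷ ps) = ↭-trans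
  (swap _ _ (edgeDiffs-spans es xs ps))
  (↭-reflexive (cong₂ (λ a b → a ∷ b ∷ _) ([x+v]-v (+ x) (+ u)) (v-[x+v] (+ x) (+ u))))

module DecideNat = Decide _≟_

-- Alternates between the labels below 2j and the 2j labels from 2 above its start, in groups
-- of four, so that the differences are 2 + d, 3 + d, …, 1 + d + 4j.
zigzag : ∀ j d {z} → d + dbl (dbl j) ≡ z → Walk (+ (d + dbl j)) (+ z)
zigzag zero d refl = ⟪ + (d + 0) ⟫
-- The end d + 4j is the same throughout the recursion; naming it z with an equation avoids
-- transporting walks.
zigzag (suc j) d eq =
  + (d + (2 + dbl j)) ▹ + dbl j ▹ + (5 + d + dbl j) ▹ + suc (dbl j) ▹ zigzag j (4 + d) (≡.trans (slide d (dbl (dbl j))) eq)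
  where
  slide : ∀ d m → 4 + d + m ≡ d + (4 + m)
  slide = solve-∀

-- One group takes the two topmost labels of the lower block and the two lowest of the upper block,
-- so what remains has the same shape with 4 + d for d.
zigzag-verts : ∀ j d {z} (eq : d + dbl (dbl j) ≡ z) →
  verts (zigzag j d eq) ↭ + (d + dbl j) ∷ run 0 (dbl j) ++ run (2 + d + dbl j) (dbl j)
zigzag-verts zero d refl = ↭-refl
zigzag-verts (suc j) d eq = prep _ (begin
  + m ∷ + (5 + d + m) ∷ + suc m ∷ verts (zigzag j (4 + d) _)
    ↭⟨ ++⁺ˡ (+ m ∷ + (5 + d + m) ∷ + suc m ∷ []) (zigzag-verts j (4 + d) _) ⟩
  + m ∷ + (5 + d + m) ∷ + suc m ∷ + (4 + d + m) ∷ run 0 m ++ run (6 + d + m) m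
    ↭⟨ solve 6 (λ a b c e r s → a ⊕ b ⊕ c ⊕ e ⊕ r ⊕ s ⊜ (r ⊕ a ⊕ c) ⊕ e ⊕ b ⊕ s) ↭-refl
         (+ m ∷ []) (+ (5 + d + m) ∷ []) (+ suc m ∷ []) (+ (4 + d + m) ∷ []) (run 0 m) (run (6 + d + m) m) ⟩
  (run 0 m ++ run m 2) ++ run (4 + d + m) (2 + m)
    ≡⟨ cong₂ _++_ (run-++ 0 m 2) (cong (λ s → run s (2 + m)) (slide d m)) ⟨
  run 0 (m + 2) ++ run (2 + d + (2 + m)) (2 + m)
    ≡⟨ cong (λ l → run 0 l ++ run (2 + d + (2 + m)) (2 + m)) (ℕ.+-comm m 2) ⟩
  run 0 (2 + m) ++ run (2 + d + (2 + m)) (2 + m) ∎)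
  where
  m = dbl j
  open PermutationReasoning
  open Rearrange ℤ
  slide : ∀ d m → 2 + d + (2 + m) ≡ 4 + d + m
  slide = solve-∀

-- One group contributes 2 + d, 5 + d, 4 + d, 3 + d in this order; the next begins at 6 + d.
zigzag-diffs : ∀ j d {z} (eq : d + dbl (dbl j) ≡ z) →
  concatMap edgeDiffs (edges (zigzag j d eq)) ↭ concatMap ± (run (2 + d) (dbl (dbl j)))
zigzag-diffs zero d refl = ↭-refl
zigzag-diffs (suc j) d eq = begin
  concatMap edgeDiffs (e₁ ∷ e₂ ∷ e₃ ∷ e₄ ∷ []) ++ concatMap edgeDiffs (edges (zigzag j (4 + d) _))
    ↭⟨ ++⁺ (edgeDiffs-spans (e₁ ∷ e₂ ∷ e₃ ∷ e₄ ∷ []) (2 + d ∷ 5 + d ∷ 4 + d ∷ 3 + d ∷ []) (fall (slide d m) ∷ climb refl ∷ fall (sym (ℕ.+-suc (4 + d) m)) ∷ climb (sym (ℕ.+-suc (3 + d) m)) ∷ []))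
           (zigzag-diffs j (4 + d) _) ⟩
  concatMap ± (map +_ (2 + d ∷ 5 + d ∷ 4 + d ∷ 3 + d ∷ [])) ++ concatMap ± (run (6 + d) (dbl m))
    ↭⟨ solve 5 (λ a b c e r → (a ⊕ b ⊕ c ⊕ e) ⊕ r ⊜ (a ⊕ e ⊕ c ⊕ b) ⊕ r) ↭-refl
         (± (+ (2 + d))) (± (+ (5 + d))) (± (+ (4 + d))) (± (+ (3 + d))) (concatMap ± (run (6 + d) (dbl m))) ⟩
  concatMap ± (run (2 + d) (4 + dbl m)) ∎
  where
  m = dbl j
  open PermutationReasoning
  open Rearrange ℤ
  e₁ e₂ e₃ e₄ : ℤ × ℤ
  e₁ = + (d + (2 + m)) , + m
  e₂ = + m , + (5 + d + m)
  e₃ = + (5 + d + m) , + suc m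
  e₄ = + suc m , + (4 + d + m)
  slide : ∀ d m → d + (2 + m) ≡ 2 + d + m
  slide = solve-∀

run-split : ∀ m b → run 0 m ++ run m (b + m) ≡ run 0 (b + dbl m)
run-split m b = ≡.trans (sym (run-++ 0 m (b + m))) (cong (run 0) (≡.trans (slide m b) (cong (λ t → b + t) (sym (dbl-+ m)))))
  where
  slide : ∀ m b → m + (b + m) ≡ b + (m + m)
  slide = solve-∀

-- The 2-cycle gives 3 twice, the edge from h + 1 to h + 2 gives 1, and the zigzag with d = 2 starts
-- at h + 2 and gives 4, ..., 3 + 2h.
core-even : ∀ j → let h = dbl j in Labeling (2 ∷ []) (dbl h) (+ suc h) (+ dbl (suc h))
core-even j = record
  { cycles = (+ m ∷ + (3 + m) ∷ []) ∷ []
  ; path = + suc m ▹ zigzag j 2 refl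
  ; lengths = refl
  ; vertices = begin
      + m ∷ + (3 + m) ∷ + suc m ∷ verts (zigzag j 2 refl)
        ↭⟨ ++⁺ˡ (+ m ∷ + (3 + m) ∷ + suc m ∷ []) (zigzag-verts j 2 refl) ⟩
      + m ∷ + (3 + m) ∷ + suc m ∷ + (2 + m) ∷ run 0 m ++ run (4 + m) m
        ↭⟨ solve 6 (λ a b c e r s → a ⊕ b ⊕ c ⊕ e ⊕ r ⊕ s ⊜ r ⊕ a ⊕ c ⊕ e ⊕ b ⊕ s) ↭-refl
             (+ m ∷ []) (+ (3 + m) ∷ []) (+ suc m ∷ []) (+ (2 + m) ∷ []) (run 0 m) (run (4 + m) m) ⟩
      run 0 m ++ run m (4 + m)
        ≡⟨ run-split m 4 ⟩
      run 0 (4 + dbl m) ∎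
  ; differences = begin
      concatMap edgeDiffs es ++ concatMap edgeDiffs (edges (zigzag j 2 refl))
        ↭⟨ ++⁺ (edgeDiffs-spans es (3 ∷ 3 ∷ 1 ∷ []) (climb refl ∷ fall refl ∷ climb refl ∷ [])) (zigzag-diffs j 2 refl) ⟩
      concatMap ± (+ 3 ∷ + 3 ∷ + 1 ∷ []) ++ concatMap ± (run 4 (dbl m))
        ↭⟨ ++⁺ʳ _ (concatMap⁺ ± (map⁺ +_ (DecideNat.decide {xs = 3 ∷ 3 ∷ 1 ∷ []} {ys = 1 ∷ 3 ∷ 3 ∷ []}))) ⟩
      concatMap ± (+ 1 ∷ + 3 ∷ + 3 ∷ run 4 (dbl m)) ∎ }
  where
  m = dbl j
  open PermutationReasoning
  open Rearrange ℤ
  es : List (ℤ × ℤ)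
  es = (+ m , + (3 + m)) ∷ (+ (3 + m) , + m) ∷ (+ suc m , + (2 + m)) ∷ []

-- The zigzag takes the labels below in pairs, so an explicit stretch first uses three of the h
-- labels below the 2-cycle. It covers the ten labels from m to m + 9 and the differences up to 9;
-- the zigzag with d = 8 continues from 8 + m with difference 10.
core-odd : ∀ j → let h = 3 + dbl j in Labeling (2 ∷ []) (dbl h) (+ suc h) (+ dbl (suc h))
core-odd j = record
  { cycles = (+ (3 + m) ∷ + (6 + m) ∷ []) ∷ []
  ; path = + (4 + m) ▹ + (5 + m) ▹ + (1 + m) ▹ + (7 + m) ▹ + (2 + m) ▹ + (9 + m) ▹ + m ▹ zigzag j 8 refl
  ; lengths = refl
  ; vertices = begin
      map place used ++ verts (zigzag j 8 refl)
        ↭⟨ ++⁺ˡ (map place used) (zigzag-verts j 8 refl) ⟩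
      map place used ++ + (8 + m) ∷ run 0 m ++ run (10 + m) m
        ↭⟨ solve 4 (λ a b r s → a ⊕ b ⊕ r ⊕ s ⊜ r ⊕ (a ⊕ b) ⊕ s) ↭-refl
             (map place used) (+ (8 + m) ∷ []) (run 0 m) (run (10 + m) m) ⟩
      run 0 m ++ map place (used ++ 8 ∷ []) ++ run (10 + m) m
        ↭⟨ ++⁺ˡ (run 0 m) (++⁺ʳ (run (10 + m) m) (map⁺ place (DecideNat.decide {xs = used ++ 8 ∷ []} {ys = upTo 10}))) ⟩
      run 0 m ++ run m (10 + m)
        ≡⟨ run-split m 10 ⟩
      run 0 (10 + dbl m) ∎
  ; differences = begin
      concatMap edgeDiffs es ++ concatMap edgeDiffs (edges (zigzag j 8 refl))
        ↭⟨ ++⁺ (edgeDiffs-spans es spanned (climb refl ∷ fall refl ∷ climb refl ∷ fall refl ∷ climb refl ∷ fall refl ∷ climb refl ∷ fall refl ∷ climb refl ∷ []))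
               (zigzag-diffs j 8 refl) ⟩
      concatMap ± (map +_ spanned) ++ concatMap ± (run 10 (dbl m))
        ↭⟨ ++⁺ʳ _ (concatMap⁺ ± (map⁺ +_ (DecideNat.decide {xs = spanned} {ys = 1 ∷ 3 ∷ 3 ∷ 4 ∷ 5 ∷ 6 ∷ 7 ∷ 8 ∷ 9 ∷ []}))) ⟩
      concatMap ± (+ 1 ∷ + 3 ∷ + 3 ∷ run 4 (6 + dbl m)) ∎ }
  where
  m = dbl j
  open PermutationReasoning
  open Rearrange ℤ
  place : ℕ → ℤ
  place i = + (i + m)
  used spanned : List ℕ
  used = 3 ∷ 6 ∷ 4 ∷ 5 ∷ 1 ∷ 7 ∷ 2 ∷ 9 ∷ 0 ∷ []
  spanned = 3 ∷ 3 ∷ 1 ∷ 4 ∷ 6 ∷ 5 ∷ 7 ∷ 9 ∷ 8 ∷ []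
  es : List (ℤ × ℤ)
  es = (+ (3 + m) , + (6 + m)) ∷ (+ (6 + m) , + (3 + m)) ∷ (+ (4 + m) , + (5 + m)) ∷ (+ (5 + m) , + (1 + m))
     ∷ (+ (1 + m) , + (7 + m)) ∷ (+ (7 + m) , + (2 + m)) ∷ (+ (2 + m) , + (9 + m)) ∷ (+ (9 + m) , + m) ∷ (+ m , + (8 + m)) ∷ []

parity : ∀ h → (∃ λ j → h ≡ dbl j) ⊎ (∃ λ j → h ≡ suc (dbl j))
parity zero = inj₁ (0 , refl)
parity (suc h) with parity h
... | inj₁ (j , eq) = inj₂ (j , cong suc eq)
... | inj₂ (j , eq) = inj₁ (suc j , cong suc eq)

-- There is no such labeling for h = 1; as the members of L exceed 2, max(L) = 2 never occurs.
core : ∀ h → h ≢ 1 → Labeling (2 ∷ []) (dbl h) (+ suc h) (+ dbl (suc h))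
core h h≢1 with parity h
... | inj₁ (j , refl) = core-even j
... | inj₂ (zero , refl) = contradiction refl h≢1
... | inj₂ (suc j , refl) = core-odd j

-- Closed forms and assembly

extent target : ℕ → ℕ → ℕ
extent h zero = dbl h
extent h (suc k) = extent h k + (suc (suc h + suc h) + suc (suc h + suc h))
target h zero = dbl (suc h)
target h (suc k) = target h k + suc (suc h + suc h)

-- With N = 2h + 3, the number of edges is N for the innermost labeling and grows by 2N with each
-- cycle, while one more than the last path label is N and grows by N.
extent-closed : ∀ h k → 3 + extent h k ≡ (2 * k + 1) * (h * 2 + 3)
extent-closed h zero = ≡.trans (cong (λ t → 3 + t) (dbl-+ h)) (lemma h)
  where
  lemma : ∀ h → 3 + (h + h) ≡ (2 * 0 + 1) * (h * 2 + 3)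
  lemma = solve-∀
extent-closed h (suc k) = ≡.trans (cong (_+ (suc (suc h + suc h) + suc (suc h + suc h))) (extent-closed h k)) (lemma h k)
  where
  lemma : ∀ h k → (2 * k + 1) * (h * 2 + 3) + (suc (suc h + suc h) + suc (suc h + suc h)) ≡ (2 * suc k + 1) * (h * 2 + 3)
  lemma = solve-∀

target-closed : ∀ h k → suc (target h k) ≡ (k + 1) * (h * 2 + 3)
target-closed h zero = ≡.trans (cong (λ t → 3 + t) (dbl-+ h)) (lemma h)
  where
  lemma : ∀ h → 3 + (h + h) ≡ (0 + 1) * (h * 2 + 3)
  lemma = solve-∀
target-closed h (suc k) = ≡.trans (cong (_+ suc (suc h + suc h)) (target-closed h k)) (lemma h k)
  where
  lemma : ∀ h k → (k + 1) * (h * 2 + 3) + suc (suc h + suc h) ≡ (suc k + 1) * (h * 2 + 3)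
  lemma = solve-∀

dbl-*2 : ∀ q → q * 2 ≡ dbl q
dbl-*2 zero = refl
dbl-*2 (suc q) = cong (λ t → suc (suc t)) (dbl-*2 q)

-- The witnesses put n = `suc h` into the form 3 + c + d expected by `tiling`.
halve : ∀ {ℓ h} → 2 ∣ ℓ → 2 < ℓ → ℓ ≤ h * 2 → ∃₂ λ c d → ℓ ≡ dbl (2 + c) × h ≡ 2 + c + d
halve (divides 1 refl) (s≤s (s≤s ())) _
halve {h = h} (divides (suc (suc c)) refl) _ ℓ≤ =
  c , h ∸ (2 + c) , dbl-*2 (2 + c) , sym (ℕ.m+[n∸m]≡n (ℕ.*-cancelʳ-≤ (2 + c) h 2 ℓ≤))

-- Every member of L is enclosed with the same n = `suc h`, whatever its size, so the number of
-- edges and the path ends depend only on h and the length of L.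
labeling : ∀ h → h ≢ 1 → ∀ L → All (λ ℓ → 2 ∣ ℓ × 2 < ℓ) L → All (_≤ h * 2) L →
  Labeling (L ++ 2 ∷ []) (extent h (length L)) (+ suc h) (+ target h (length L))
labeling h h≢1 [] _ _ = core h h≢1
labeling h h≢1 (ℓ ∷ L) ((2∣ℓ , 2<ℓ) ∷ ev) (ℓ≤ ∷ bd) with halve {h = h} 2∣ℓ 2<ℓ ℓ≤
... | c , d , refl , refl = enclose (tiling c d) (labeling h h≢1 L ev bd)

maxL-bounds : ∀ L → All (_≤ maxL L) L
maxL-bounds [] = []
maxL-bounds (ℓ ∷ L) = ℕ.m≤m⊔n ℓ (maxL L) ∷ All.map (λ ≤m → ℕ.≤-trans ≤m (ℕ.m≤n⊔m ℓ (maxL L))) (maxL-bounds L)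

maxL-even : ∀ L → All (2 ∣_) L → 2 ∣ maxL L
maxL-even [] [] = divides 0 refl
maxL-even (ℓ ∷ L) (2∣ℓ ∷ ev) with ℕ.⊔-sel ℓ (maxL L)
... | inj₁ eq = subst (2 ∣_) (sym eq) 2∣ℓ
... | inj₂ eq = subst (2 ∣_) (sym eq) (maxL-even L ev)

maxL-≢2 : ∀ L → All (2 <_) L → maxL L ≢ 2
maxL-≢2 (ℓ ∷ L) (2<ℓ ∷ _) eq = ℕ.<-irrefl (sym eq) (ℕ.<-≤-trans 2<ℓ (ℕ.m≤m⊔n ℓ (maxL L)))

twos-++2 : ∀ L → All (2 <_) L → twos (L ++ 2 ∷ []) ≡ 1
twos-++2 [] [] = refl
twos-++2 (ℓ ∷ L) (2<ℓ ∷ gt) = ≡.trans (cong length (filter-reject (_≟ 2) (λ eq → ℕ.<-irrefl (sym eq) 2<ℓ))) (twos-++2 L gt)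

length-concat : ∀ {A : Set} (xss : List (List A)) → length (concat xss) ≡ sum (map length xss)
length-concat [] = refl
length-concat (xs ∷ xss) = ≡.trans (length-++ xs) (cong (λ t → length xs + t) (length-concat xss))

length-run : ∀ s l → length (run s l) ≡ l
length-run s zero = refl
length-run s (suc l) = cong suc (length-run (suc s) l)

-- The length of the path follows by counting the 4 + e labels. Since the path has at least one
-- vertex, `sum Ls` is at most 3 + e and the truncated subtraction in m is exact.
labeling⇒GL : ∀ {Ls e x y m} → Labeling Ls e x y → twos Ls ≡ 1 → m ≡ 3 + e ∸ sum Ls → GL Ls m x y
labeling⇒GL {Ls} {e} {x} {y} Γ one refl = record
  { cycles = cycles
  ; path = verts path
  ; cycleLens = lengths
  ; pathLen = ≡.trans (sym (ℕ.m+n∸m≡n (sum Ls) (length (verts path)))) (≡.trans (cong (_∸ sum Ls) total) (ℕ.+-∸-assoc 1 sum≤))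
  ; atMostOne2 = ℕ.≤-reflexive one
  ; vertices = subst (λ ε → concat cycles ++ verts path ↭ interval 0 ε) (sym edge-count)
      (↭-trans vertices (↭-reflexive (sym (interval-run 0 (3 + e)))))
  ; pathStart = head-verts path
  ; pathEnd = last-verts path
  ; diffs = subst (λ es → concatMap edgeDiffs (concat (map cycleEdges cycles) ++ es) ↭ targetDiffs (twos Ls) (sum Ls + (3 + e ∸ sum Ls))) (sym (pairs-verts path))
      (↭-trans differences (↭-trans (concatMap-± _)
        (↭-reflexive (sym (≡.trans (cong₂ targetDiffs one edge-count) (cong (λ xs → pm (+ 1 ∷ + 3 ∷ + 3 ∷ xs)) (interval-run 4 (3 + e))))))))
  }
  where
  open Labeling Γ
  total : sum Ls + length (verts path) ≡ 4 + e
  total = ≡.trans (cong (_+ length (verts path)) (≡.trans (cong sum (sym lengths)) (sym (length-concat cycles))))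
    (≡.trans (sym (length-++ (concat cycles))) (≡.trans (↭-length vertices) (length-run 0 (4 + e))))
  nonempty : ∀ {a b} (w : Walk {ℤ} a b) → 1 ≤ length (verts w)
  nonempty ⟪ _ ⟫ = s≤s z≤n
  nonempty (_ ▹ _) = s≤s z≤n
  sum≤ : sum Ls ≤ 3 + e
  sum≤ = s≤s⁻¹ (subst (suc (sum Ls) ≤_) total (subst (_≤ sum Ls + length (verts path)) (ℕ.+-comm (sum Ls) 1) (ℕ.+-monoʳ-≤ (sum Ls) (nonempty path))))
  edge-count : sum Ls + (3 + e ∸ sum Ls) ≡ 3 + e
  edge-count = ℕ.m+[n∸m]≡n sum≤

theorem5p1 : (L : List ℕ) → All (λ ℓ → (2 ∣ ℓ) × (2 < ℓ)) L →
    let ε = (2 * length L + 1) * (maxL L + 3) in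
    GL (L ++ 2 ∷ []) (ε ∸ sum L ∸ 2)
    (+ (maxL L / 2 + 1))
    (+ ((length L + 1) * (maxL L + 3) ∸ 1))
theorem5p1 L ev with maxL-even L (All.map proj₁ ev) | maxL-bounds L | maxL-≢2 L (All.map proj₂ ev)
-- Rewriting turns `maxL L` into `h * 2`, so that x becomes `suc h` and the factor `maxL L + 3`
-- becomes N; h = 1 would make the maximum 2.
... | divides h eq | bd | ≢2 rewrite eq = subst₂ (GL (L ++ 2 ∷ []) _)
  (cong +_ (≡.trans (sym (ℕ.+-comm h 1)) (cong (_+ 1) (sym (m*n/n≡m h 2)))))
  (cong (λ t → + (t ∸ 1)) (target-closed h (length L)))
  (labeling⇒GL (labeling h (λ { refl → ≢2 refl }) L ev bd) (twos-++2 L (All.map proj₂ ev)) edge-count)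
  where
  edge-count : (2 * length L + 1) * (h * 2 + 3) ∸ sum L ∸ 2 ≡ 3 + extent h (length L) ∸ sum (L ++ 2 ∷ [])
  edge-count = ≡.trans (ℕ.∸-+-assoc ((2 * length L + 1) * (h * 2 + 3)) (sum L) 2)
    (cong₂ _∸_ (sym (extent-closed h (length L))) (sym (sum-++ L (2 ∷ []))))
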